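{- Fix a prime $p$ and an integer $m\geq 1$. For every $n\geq 1$, let $\mathbf{X}$ be a $\mathbb{Z}^{n\times n}$-valued random matrix whose entries are independent and uniformly distributed on $\{0,1,\ldots,p^{m}-1\}$, and let $b\in\mathbb{Z}^n$ be a deterministic vector with $b\not\equiv 0 \bmod p$. Let $\mathbf{W}\in\mathbb{Z}^{n\times n}$ be the walk matrix with columns $b,\mathbf{X}b,\ldots,\mathbf{X}^{n-1}b$. Fix some $\ell\geq 1$ and integers $0=\lambda_0\leq\lambda_1\leq\cdots\leq\lambda_\ell\leq m$. Let $i_0:=\#\{i\leq \ell:\lambda_i=m\}$ and $\delta_j:=\lambda_{\ell-j+1}-\lambda_{\ell-j}$ for $1\le j\le \ell$. Then, as Abelian groups, $$\lim_{n\to\infty}\mathbb{P}\Big(\operatorname{coker}(\mathbf{W})_{p^m}\cong\bigoplus_{i=1}^{\ell}\mathbb{Z}/p^{\lambda_i}\mathbb{Z}\Big)=\prod_{i=i_0}^{\infty}\big(1-p^{ -(i+1)}\big)\prod_{j=1}^{\ell}p^{ -j\delta_j}.$$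
   Context: For an integer matrix $\mathbf{M}\in\mathbb{Z}^{n\times n}$, $\operatorname{coker}(\mathbf{M}):=\mathbb{Z}^n/\mathbf{M}(\mathbb{Z}^n)$. For an Abelian group $H$ and a prime power $p^m$, $H_{p^m}:=H/p^mH$. -}

module Defs where

open import Data.Nat as ℕ using (ℕ; zero; suc; _^_; _∸_)
open import Data.Nat.Properties using (m^n≢0)
open import Data.Nat.Primality using (Prime; prime⇒nonZero)
open import Data.Integer as ℤ using (ℤ; +_)
open import Data.Integer.Divisibility using () renaming (_∣_ to _∣ℤ_)
open import Data.Fin using (Fin; zero; suc; toℕ)
open import Data.List using (List; []; _∷_; map; concatMap; length; filter; upTo)
open import Data.Product using (Σ; ∃; _×_)
open import Data.Rational as ℚ using (ℚ; 1ℚ)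
open import Relation.Nullary using (Dec)
open import Relation.Unary using (Decidable)
open import Relation.Binary.PropositionalEquality using (_≡_)

Vecℤ : ℕ → Set
Vecℤ n = Fin n → ℤ

Matℤ : ℕ → Set
Matℤ n = Fin n → Fin n → ℤ

Σℤ : (k : ℕ) → (Fin k → ℤ) → ℤ
Σℤ zero    f = + 0
Σℤ (suc k) f = f zero ℤ.+ Σℤ k (λ i → f (suc i))

_·v_ : ∀ {n} → Matℤ n → Vecℤ n → Vecℤ n
(M ·v v) i = Σℤ _ (λ j → M i j ℤ.* v j)

_+v_ : ∀ {n} → Vecℤ n → Vecℤ n → Vecℤ n
(v +v w) i = v i ℤ.+ w i

powApply : ∀ {n} → Matℤ n → ℕ → Vecℤ n → Vecℤ n
powApply X zero    b = b
powApply X (suc k) b = X ·v powApply X k b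

walk : ∀ {n} → Matℤ n → Vecℤ n → Matℤ n
walk X b i j = powApply X (toℕ j) b i

-- coker(W)_{q} = ℤ^n / (W ℤ^n + q ℤ^n), presented by its congruence
-- relation on ℤ^n (group operation: pointwise addition).

CokerRel : ∀ {n} → Matℤ n → ℕ → Vecℤ n → Vecℤ n → Set
CokerRel {n} W q v w =
  Σ (Vecℤ n) λ u → Σ (Vecℤ n) λ t →
    ∀ i → v i ℤ.- w i ≡ (W ·v u) i ℤ.+ (+ q) ℤ.* t i

-- ⊕_{i=1}^{ℓ} ℤ/p^{λ_i}ℤ, presented as ℤ^ℓ modulo the congruence relation
-- (coordinate i : Fin ℓ corresponds to the summand ℤ/p^{λ_{i+1}}).
SumRel : (p ℓ : ℕ) → (ℕ → ℕ) → Vecℤ ℓ → Vecℤ ℓ → Set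
SumRel p ℓ lam v w = ∀ (i : Fin ℓ) → (+ (p ^ lam (suc (toℕ i)))) ∣ℤ (v i ℤ.- w i)

-- Isomorphism of the Abelian groups ℤ^a/R and ℤ^b/S (R, S congruences for
-- pointwise addition): a map respecting the relations, additive modulo S,
-- injective and surjective on classes.
QuotIso : (a b : ℕ) → (Vecℤ a → Vecℤ a → Set) → (Vecℤ b → Vecℤ b → Set) → Set
QuotIso a b R S =
  Σ (Vecℤ a → Vecℤ b) λ f →
      (∀ v w → R v w → S (f v) (f w))
    × (∀ v w → S (f (v +v w)) (f v +v f w))
    × (∀ v w → S (f v) (f w) → R v w)
    × (∀ y → ∃ λ v → S (f v) y)

_∷ᶠ_ : ∀ {A : Set} {k} → A → (Fin k → A) → Fin (suc k) → A
(a ∷ᶠ f) zero    = a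
(a ∷ᶠ f) (suc i) = f i

allFuns : ∀ {A : Set} → List A → (k : ℕ) → List (Fin k → A)
allFuns xs zero    = (λ ()) ∷ []
allFuns xs (suc k) = concatMap (λ a → map (a ∷ᶠ_) (allFuns xs k)) xs

allFinL : (q : ℕ) → List (Fin q)
allFinL zero    = []
allFinL (suc q) = zero ∷ map suc (allFinL q)

allMats : (q n : ℕ) → List (Fin n → Fin n → Fin q)
allMats q n = allFuns (allFuns (allFinL q) n) n

toMatℤ : ∀ {q n} → (Fin n → Fin n → Fin q) → Matℤ n
toMatℤ X i j = + toℕ (X i j)

prob : (q n : ℕ) → .{{_ : ℕ.NonZero q}} →
       {P : (Fin n → Fin n → Fin q) → Set} → Decidable P → ℚ
prob q n P? = (+ length (filter P? (allMats q n))) ℚ./ (q ^ (n ℕ.* n))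
  where instance _ = m^n≢0 q (n ℕ.* n)

pinv : (p : ℕ) → Prime p → ℕ → ℚ
pinv p pp k = (+ 1) ℚ./ (p ^ k)
  where instance _ = prime⇒nonZero pp
                 _ = m^n≢0 p k

prodFrom : (ℕ → ℚ) → ℕ → ℕ → ℚ
prodFrom f a zero    = f a
prodFrom f a (suc K) = f a ℚ.* prodFrom f (suc a) K

prod1to : (ℕ → ℚ) → ℕ → ℚ
prod1to f zero    = 1ℚ
prod1to f (suc ℓ) = prod1to f ℓ ℚ.* f (suc ℓ)

i₀ : (ℓ m : ℕ) → (ℕ → ℕ) → ℕ
i₀ ℓ m lam = length (filter (λ i → lam i ℕ.≟ m) (map suc (upTo ℓ)))

δ : ℕ → (ℕ → ℕ) → ℕ → ℕ
δ ℓ lam j = lam (suc (ℓ ∸ j)) ∸ lam (ℓ ∸ j)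

limitPartial : (p : ℕ) → Prime p → (ℓ m : ℕ) → (ℕ → ℕ) → ℕ → ℚ
limitPartial p pp ℓ m lam K =
  prodFrom (λ i → 1ℚ ℚ.- pinv p pp (suc i)) (i₀ ℓ m lam) K
  ℚ.* prod1to (λ j → pinv p pp (j ℕ.* δ ℓ lam j)) ℓ

WalkEvent : (p m ℓ : ℕ) → (ℕ → ℕ) → (n : ℕ) → Vecℤ (suc n) →
            (Fin (suc n) → Fin (suc n) → Fin (p ^ m)) → Set
WalkEvent p m ℓ lam n b X =
  QuotIso (suc n) ℓ (CokerRel (walk (toMatℤ X) b) (p ^ m)) (SumRel p ℓ lam)

walkProb : (p : ℕ) → Prime p → (m ℓ : ℕ) → (lam : ℕ → ℕ) → (n : ℕ) →
           (b : Vecℤ (suc n)) → Decidable (WalkEvent p m ℓ lam n b) → ℚ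
walkProb p pp m ℓ lam n b dec = prob (p ^ m) (suc n) dec
  where instance _ = prime⇒nonZero pp
                 _ = m^n≢0 p m

{-# OPTIONS --safe #-}
module Submission where

-- Put R = ℤ/pᵐ.  If y = pᵃ c u with c a unit and u i = 1, then projecting R^(n+1) along u
-- identifies R^(n+1) / R[X]y with ℤ/pᵃ ⊕ Rⁿ / R[B](pᵃ y′), where B is the compression of X to the
-- remaining coordinates and y′ the projection of X u.  For uniform X the pair (y′ , B) is again
-- uniform.  Iterating, the exponents of the cokernel form a nondecreasing Markov chain
-- a₁ ≤ a₂ ≤ …, with aₖ₊₁ = min (m , aₖ + v(z)) for z uniform in R^r, r being the remaining rank;
-- the step a → a′ has probability p^(− r (a′ − a)), times 1 − p^(− r) when a′ < m.  As the
-- exponents determine the group, multiplying the steps gives the probability for matrices of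
-- size n + 1 exactly: it is the partial product of the limit up to the factor 1 − p^(− n).

-- The reduction closes up because of divisibility. As y is a multiple of pᵃ, so is every f(X)y, in
-- particular its coordinate at i. In π(Xw) that coordinate multiplies y′, so only multiples of pᵃy′
-- occur. Hence the new starting vector is pᵃy′, and hence exponents never decrease. Each coordinate
-- removed costs one multiplication by X, so the degree bound of `Kry` falls in step with the rank.
-- The pivot is chosen from y alone, so one linear change of variables serves all matrices X at
-- once. The resulting count depends on y only through its valuation, and this is what makes the
-- exponents a Markov chain. That exponents determine the group is also what makes the reduction
-- reversible: a summand is cancelled by computing the type of the reduced pair and comparing lists.
-- All counting is done in natural numbers; rationals enter when the count is divided by the number
-- of matrices. The probability for size n + 1 then equals one of the partial products, so
-- convergence comes down to comparing two partial products of the same sequence.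

open import Defs
open import Data.Fin using (Fin; zero; suc; punchIn; punchOut; _≟_; toℕ; fromℕ<; combine; remQuot)
open import Data.Fin.Properties using (punchIn-punchOut)
import Data.Fin.Properties as Finₚ
open import Data.Integer as ℤ using (ℤ; +_; _+_; _*_; _-_; -_; 0ℤ; 1ℤ)
open import Data.Integer.DivMod using (_%ℕ_; _/ℕ_; n%ℕd<d; a≡a%ℕn+[a/ℕn]*n)
open import Data.Integer.Divisibility using () renaming (_∣_ to _∣ℤ_)
open import Data.Integer.Divisibility.Signed using (_∣_; divides; ∣-trans; ∣m∣n⇒∣m+n; ∣m⇒∣-m; ∣n⇒∣m*n; ∣m⇒∣m*n; ∣⇒∣ᵤ; _∣?_; ∣ᵤ⇒∣; *-cancelˡ-∣)
import Data.Integer.Properties as ℤₚ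
open import Data.Integer.Tactic.RingSolver using (solve-∀)
open import Data.List using (List; []; _∷_; _++_; map; concatMap; length; filter; upTo; applyUpTo)
open import Data.Nat as ℕ using (ℕ; zero; suc; _^_; _⊓_; _<_; _≤_; NonZero; _∸_; _≤′_; ≤′-refl; ≤′-step)
open import Data.Nat.Coprimality using (Coprime; coprime-Bézout)
import Data.Nat.Divisibility as ℕ∣
open import Data.Nat.GCD using (module Bézout)
open import Data.Nat.Primality using (Prime; prime⇒nonTrivial; prime⇒irreducible; prime⇒nonZero)
import Data.Nat.Properties as ℕₚ
open import Data.Nat.Tactic.RingSolver using () renaming (solve-∀ to solveℕ-∀)
open import Data.Product using (Σ; _×_; _,_; proj₁; proj₂; ∃)
open import Data.Rational as ℚ using (ℚ; 0ℚ; 1ℚ; toℚᵘ)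
import Data.Rational.Properties as ℚₚ
open import Data.Rational.Solver using (module +-*-Solver)
import Data.Rational.Unnormalised as ℚᵘ
import Data.Rational.Unnormalised.Properties as ℚᵘₚ
open import Data.Sum using (inj₁; inj₂)
open import Data.Unit using (⊤; tt)
open import Data.Vec.Functional using (insertAt)
open import Data.Vec.Functional.Properties using (insertAt-lookup; insertAt-punchIn)
open import Function using (_∘_; id)
open import Relation.Binary.PropositionalEquality using (_≡_; _≗_; refl; sym; trans; cong; cong₂; subst; module ≡-Reasoning; _≢_)
open import Relation.Nullary using (yes; no; contradiction; ¬_; Dec)
open import Relation.Nullary.Decidable using (map′)
open import Relation.Unary using (Decidable)

-- Congruences and sums of integers

infix 4 _≈_[mod_] _≋_[mod_]

record _≈_[mod_] (x y : ℤ) (d : ℕ) : Set where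
  constructor ⟪_⟫
  field ∣diff : + d ∣ x - y
open _≈_[mod_] public

≡⇒≈ : ∀ {d x y} → x ≡ y → x ≈ y [mod d ]
≡⇒≈ {d} {x} refl = ⟪ divides 0ℤ (ℤₚ.+-inverseʳ x) ⟫

≈-refl : ∀ {d x} → x ≈ x [mod d ]
≈-refl = ≡⇒≈ refl

≈-sym : ∀ {d x y} → x ≈ y [mod d ] → y ≈ x [mod d ]
≈-sym {d} {x} {y} ⟪ d∣ ⟫ = ⟪ subst (+ d ∣_) (eq x y) (∣m⇒∣-m d∣) ⟫
  where
  eq : ∀ x y → - (x - y) ≡ y - x
  eq = solve-∀

≈-trans : ∀ {d x y z} → x ≈ y [mod d ] → y ≈ z [mod d ] → x ≈ z [mod d ]
≈-trans {d} {x} {y} {z} ⟪ h ⟫ ⟪ k ⟫ = ⟪ subst (+ d ∣_) (eq x y z) (∣m∣n⇒∣m+n h k) ⟫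
  where
  eq : ∀ x y z → (x - y) + (y - z) ≡ x - z
  eq = solve-∀

≈-respˡ : ∀ {d x x′ y} → x ≡ x′ → x ≈ y [mod d ] → x′ ≈ y [mod d ]
≈-respˡ refl h = h

≈-respʳ : ∀ {d x y y′} → y ≡ y′ → x ≈ y [mod d ] → x ≈ y′ [mod d ]
≈-respʳ refl h = h

+-cong-≈ : ∀ {d x x′ y y′} → x ≈ x′ [mod d ] → y ≈ y′ [mod d ] → x + y ≈ x′ + y′ [mod d ]
+-cong-≈ {d} {x} {x′} {y} {y′} ⟪ h ⟫ ⟪ k ⟫ = ⟪ subst (+ d ∣_) (eq x x′ y y′) (∣m∣n⇒∣m+n h k) ⟫
  where
  eq : ∀ x x′ y y′ → (x - x′) + (y - y′) ≡ (x + y) - (x′ + y′)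
  eq = solve-∀

neg-cong-≈ : ∀ {d x x′} → x ≈ x′ [mod d ] → - x ≈ - x′ [mod d ]
neg-cong-≈ {d} {x} {x′} ⟪ h ⟫ = ⟪ subst (+ d ∣_) (eq x x′) (∣m⇒∣-m h) ⟫
  where
  eq : ∀ x x′ → - (x - x′) ≡ (- x) - (- x′)
  eq = solve-∀

minus-cong-≈ : ∀ {d x x′ y y′} → x ≈ x′ [mod d ] → y ≈ y′ [mod d ] → x - y ≈ x′ - y′ [mod d ]
minus-cong-≈ h k = +-cong-≈ h (neg-cong-≈ k)

*-cong-≈ : ∀ {d x x′ y y′} → x ≈ x′ [mod d ] → y ≈ y′ [mod d ] → x * y ≈ x′ * y′ [mod d ]
*-cong-≈ {d} {x} {x′} {y} {y′} ⟪ h ⟫ ⟪ k ⟫ =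
  ⟪ subst (+ d ∣_) (eq x x′ y y′) (∣m∣n⇒∣m+n (∣m⇒∣m*n y h) (∣n⇒∣m*n x′ k)) ⟫
  where
  eq : ∀ x x′ y y′ → (x - x′) * y + x′ * (y - y′) ≡ x * y - x′ * y′
  eq = solve-∀

≈-weaken : ∀ {d d′ x y} → + d′ ∣ + d → x ≈ y [mod d ] → x ≈ y [mod d′ ]
≈-weaken d′∣d ⟪ h ⟫ = ⟪ ∣-trans d′∣d h ⟫

multiple-≈0 : ∀ d s → s * + d ≈ 0ℤ [mod d ]
multiple-≈0 d s = ⟪ divides s (ℤₚ.+-identityʳ (s * + d)) ⟫

≈0⇒multiple : ∀ {d x} (h : x ≈ 0ℤ [mod d ]) → x ≡ _∣_.quotient (∣diff h) * + d
≈0⇒multiple {d} {x} ⟪ divides s eq ⟫ = trans (sym (ℤₚ.+-identityʳ x)) eq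

≈⇒-≈0 : ∀ {d x y} → x ≈ y [mod d ] → x - y ≈ 0ℤ [mod d ]
≈⇒-≈0 {d} {x} {y} ⟪ h ⟫ = ⟪ subst (+ d ∣_) (sym (ℤₚ.+-identityʳ (x - y))) h ⟫

-≈0⇒≈ : ∀ {d x y} → x - y ≈ 0ℤ [mod d ] → x ≈ y [mod d ]
-≈0⇒≈ {d} {x} {y} ⟪ h ⟫ = ⟪ subst (+ d ∣_) (ℤₚ.+-identityʳ (x - y)) h ⟫

_≋_[mod_] : ∀ {n} → Vecℤ n → Vecℤ n → ℕ → Set
v ≋ w [mod d ] = ∀ i → v i ≈ w i [mod d ]

Σℤ-cong : ∀ {n} {f g : Fin n → ℤ} → f ≗ g → Σℤ n f ≡ Σℤ n g
Σℤ-cong {zero}  h = refl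
Σℤ-cong {suc n} h = cong₂ _+_ (h zero) (Σℤ-cong (h ∘ suc))

Σℤ-cong-≈ : ∀ {d n} {f g : Fin n → ℤ} → f ≋ g [mod d ] → Σℤ n f ≈ Σℤ n g [mod d ]
Σℤ-cong-≈ {n = zero}  h = ≈-refl
Σℤ-cong-≈ {n = suc n} h = +-cong-≈ (h zero) (Σℤ-cong-≈ (h ∘ suc))

Σℤ-zero : ∀ n → Σℤ n (λ _ → 0ℤ) ≡ 0ℤ
Σℤ-zero zero    = refl
Σℤ-zero (suc n) = trans (ℤₚ.+-identityˡ _) (Σℤ-zero n)

Σℤ-+ : ∀ {n} (f g : Fin n → ℤ) → Σℤ n (λ i → f i + g i) ≡ Σℤ n f + Σℤ n g
Σℤ-+ {zero}  f g = refl
Σℤ-+ {suc n} f g = trans (cong₂ _+_ {x = (f zero + g zero)} refl (Σℤ-+ (f ∘ suc) (g ∘ suc)))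
  (eq (f zero) (g zero) (Σℤ n (f ∘ suc)) (Σℤ n (g ∘ suc)))
  where
  eq : ∀ a b c d → a + b + (c + d) ≡ a + c + (b + d)
  eq = solve-∀

Σℤ-* : ∀ {n} c (f : Fin n → ℤ) → Σℤ n (λ i → c * f i) ≡ c * Σℤ n f
Σℤ-* {zero}  c f = sym (ℤₚ.*-zeroʳ c)
Σℤ-* {suc n} c f = trans (cong₂ _+_ {x = c * f zero} refl (Σℤ-* c (f ∘ suc))) (sym (ℤₚ.*-distribˡ-+ c (f zero) _))

Σℤ-swap : ∀ {n k} (f : Fin n → Fin k → ℤ) →
  Σℤ n (λ i → Σℤ k (f i)) ≡ Σℤ k (λ j → Σℤ n (λ i → f i j))
Σℤ-swap {zero}  {k} f = sym (Σℤ-zero k)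
Σℤ-swap {suc n} {k} f = trans (cong₂ _+_ {x = Σℤ k (f zero)} refl (Σℤ-swap (f ∘ suc))) (sym (Σℤ-+ (f zero) _))

Σℤ-remove : ∀ {n} (i : Fin (suc n)) (f : Fin (suc n) → ℤ) → Σℤ (suc n) f ≡ f i + Σℤ n (f ∘ punchIn i)
Σℤ-remove {n}     zero    f = refl
Σℤ-remove {suc n} (suc i) f = trans (cong₂ _+_ {x = f zero} refl (Σℤ-remove i (f ∘ suc)))
  (eq (f zero) (f (suc i)) (Σℤ n (f ∘ suc ∘ punchIn i)))
  where
  eq : ∀ a b c → a + (b + c) ≡ b + (a + c)
  eq = solve-∀

infix 8 _∙_
_∙_ : ∀ {n} → Vecℤ n → Vecℤ n → ℤ
r ∙ v = Σℤ _ (λ j → r j * v j)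

∙-cong-≈ : ∀ {d n} {r r′ v v′ : Vecℤ n} → r ≋ r′ [mod d ] → v ≋ v′ [mod d ] → r ∙ v ≈ r′ ∙ v′ [mod d ]
∙-cong-≈ h k = Σℤ-cong-≈ (λ j → *-cong-≈ (h j) (k j))

∙-linearʳ : ∀ {n} (r v w : Vecℤ n) s → r ∙ (λ j → s * v j + w j) ≡ s * r ∙ v + r ∙ w
∙-linearʳ {n} r v w s = begin
  r ∙ (λ j → s * v j + w j)                     ≡⟨ Σℤ-cong (λ j → eq (r j) s (v j) (w j)) ⟩
  Σℤ n (λ j → s * (r j * v j) + r j * w j)      ≡⟨ Σℤ-+ (λ j → s * (r j * v j)) (λ j → r j * w j) ⟩
  Σℤ n (λ j → s * (r j * v j)) + r ∙ w          ≡⟨ cong (_+ r ∙ w) (Σℤ-* s (λ j → r j * v j)) ⟩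
  s * r ∙ v + r ∙ w                             ∎
  where
  open ≡-Reasoning
  eq : ∀ r s v w → r * (s * v + w) ≡ s * (r * v) + r * w
  eq = solve-∀

∙-comm : ∀ {n} (r v : Vecℤ n) → r ∙ v ≡ v ∙ r
∙-comm r v = Σℤ-cong (λ j → ℤₚ.*-comm (r j) (v j))

∙-zeroʳ-≈ : ∀ {d n} (r : Vecℤ n) {v : Vecℤ n} → (∀ i → v i ≈ 0ℤ [mod d ]) → r ∙ v ≈ 0ℤ [mod d ]
∙-zeroʳ-≈ {n = n} r h =
  ≈-trans (Σℤ-cong-≈ (λ j → ≈-respʳ (ℤₚ.*-zeroʳ (r j)) (*-cong-≈ (≈-refl {x = r j}) (h j)))) (≡⇒≈ (Σℤ-zero n))

∙-insertAt : ∀ {n} (i : Fin (suc n)) (r : Vecℤ (suc n)) (w : Vecℤ n) s →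
  r ∙ insertAt w i s ≡ r i * s + (r ∘ punchIn i) ∙ w
∙-insertAt i r w s = trans (Σℤ-remove i (λ j → r j * insertAt w i s j))
  (cong₂ _+_ (cong (r i *_) (insertAt-lookup w i s)) (Σℤ-cong (λ j → cong (r (punchIn i j) *_) (insertAt-punchIn w i s j))))

∙-linearˡ : ∀ {n} (r t v : Vecℤ n) s → (λ j → r j - s * t j) ∙ v ≡ r ∙ v - s * t ∙ v
∙-linearˡ r t v s = begin
  (λ j → r j - s * t j) ∙ v          ≡⟨ Σℤ-cong (λ j → eq (r j) s (t j) (v j)) ⟩
  v ∙ (λ j → (- s) * t j + r j)      ≡⟨ ∙-linearʳ v t r (- s) ⟩
  (- s) * v ∙ t + v ∙ r              ≡⟨ cong₂ (λ a b → (- s) * a + b) (∙-comm v t) (∙-comm v r) ⟩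
  (- s) * t ∙ v + r ∙ v              ≡⟨ eq′ s (t ∙ v) (r ∙ v) ⟩
  r ∙ v - s * t ∙ v                  ∎
  where
  open ≡-Reasoning
  eq : ∀ r s t v → (r - s * t) * v ≡ v * ((- s) * t + r)
  eq = solve-∀
  eq′ : ∀ s a b → (- s) * a + b ≡ b - s * a
  eq′ = solve-∀

-- Krylov submodules

punchIn-elim : ∀ {n} (P : Fin (suc n) → Set) (i : Fin (suc n)) →
  P i → (∀ j → P (punchIn i j)) → ∀ k → P k
punchIn-elim P i Pi P′ k with i ≟ k
... | yes refl = Pi
... | no i≢k   = subst P (punchIn-punchOut i≢k) (P′ (punchOut i≢k))

-- Division with remainder along u, where u i = 1: v = v i · u + (π v, with a 0 inserted at i).
module Reduction {n} (i : Fin (suc n)) (u : Vecℤ (suc n)) where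

  π : Vecℤ (suc n) → Vecℤ n
  π v j = v (punchIn i j) - u (punchIn i j) * v i

  -- X followed by `π`: `rows X j ∙ v` is `π (X ·v v) j`. So `next` is `π (X ·v u)`, and column k of
  -- `block` is the projection of the image of the basis vector at `punchIn i k`.
  rows : Matℤ (suc n) → Fin n → Vecℤ (suc n)
  rows X j k = X (punchIn i j) k - u (punchIn i j) * X i k

  next : Matℤ (suc n) → Vecℤ n
  next X j = rows X j ∙ u

  block : Matℤ (suc n) → Matℤ n
  block X j k = rows X j (punchIn i k)

  π-cong-≈ : ∀ {d v w} → v ≋ w [mod d ] → π v ≋ π w [mod d ]
  π-cong-≈ h j = minus-cong-≈ (h (punchIn i j)) (*-cong-≈ (≈-refl {x = u (punchIn i j)}) (h i))

  π-linear : ∀ s v w j → π (λ k → s * v k + w k) j ≡ s * π v j + π w j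
  π-linear s v w j = eq s (v (punchIn i j)) (w (punchIn i j)) (u (punchIn i j)) (v i) (w i)
    where
    eq : ∀ s a b c x y → (s * a + b) - c * (s * x + y) ≡ s * (a - c * x) + (b - c * y)
    eq = solve-∀

  module _ (uᵢ≡1 : u i ≡ 1ℤ) where

    decompose : ∀ v k → v k ≡ v i * u k + insertAt (π v) i 0ℤ k
    decompose v = punchIn-elim _ i at-i off-i
      where
      eq : ∀ x → x ≡ x * 1ℤ + 0ℤ
      eq = solve-∀
      eq′ : ∀ x y c → x ≡ y * c + (x - c * y)
      eq′ = solve-∀
      at-i : v i ≡ v i * u i + insertAt (π v) i 0ℤ i
      at-i rewrite uᵢ≡1 | insertAt-lookup (π v) i 0ℤ = eq (v i)
      off-i : ∀ j → v (punchIn i j) ≡ v i * u (punchIn i j) + insertAt (π v) i 0ℤ (punchIn i j)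
      off-i j rewrite insertAt-punchIn (π v) i 0ℤ j = eq′ (v (punchIn i j)) (v i) (u (punchIn i j))

    lift : ℤ → Vecℤ n → Vecℤ (suc n)
    lift s w k = s * u k + insertAt w i 0ℤ k

    lift-i : ∀ s w → lift s w i ≡ s
    lift-i s w rewrite uᵢ≡1 | insertAt-lookup w i 0ℤ = eq s
      where
      eq : ∀ s → s * 1ℤ + 0ℤ ≡ s
      eq = solve-∀

    π-lift : ∀ s w → π (lift s w) ≗ w
    π-lift s w j rewrite lift-i s w | insertAt-punchIn w i 0ℤ j = eq s (u (punchIn i j)) (w j)
      where
      eq : ∀ s c x → s * c + x - c * s ≡ x
      eq = solve-∀

    π-·v : ∀ X v j → π (X ·v v) j ≡ v i * next X j + (block X ·v π v) j
    π-·v X v j = begin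
      π (X ·v v) j                                             ≡⟨ ∙-linearˡ (X (punchIn i j)) (X i) v (u (punchIn i j)) ⟨
      r ∙ v                                                    ≡⟨ Σℤ-cong (λ k → cong (r k *_) (decompose v k)) ⟩
      r ∙ (λ k → v i * u k + insertAt (π v) i 0ℤ k)            ≡⟨ ∙-linearʳ r u (insertAt (π v) i 0ℤ) (v i) ⟩
      v i * next X j + r ∙ insertAt (π v) i 0ℤ                 ≡⟨ cong₂ _+_ {x = v i * next X j} refl (∙-insertAt i r (π v) 0ℤ) ⟩
      v i * next X j + (r i * 0ℤ + (block X ·v π v) j)         ≡⟨ eq (v i * next X j) (r i) ((block X ·v π v) j) ⟩
      v i * next X j + (block X ·v π v) j                      ∎
      where
      open ≡-Reasoning
      r = rows X j
      eq : ∀ a b c → a + (b * 0ℤ + c) ≡ a + c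
      eq = solve-∀

module Krylov (q : ℕ) where

  -- The classes modulo q of f(X)y for polynomials f of degree below k, in Horner form.
  Kry : ∀ {n} → ℕ → Matℤ n → Vecℤ n → Vecℤ n → Set
  Kry zero    X y v = ∀ i → v i ≈ 0ℤ [mod q ]
  Kry (suc k) X y v = Σ ℤ λ c → Σ (Vecℤ _) λ w → Kry k X y w × (∀ i → v i ≈ c * y i + (X ·v w) i [mod q ])

  Kry-resp : ∀ {n} k {X X′ : Matℤ n} {y y′ v v′} → (∀ i → X i ≋ X′ i [mod q ]) → y ≋ y′ [mod q ] → v ≋ v′ [mod q ] →
    Kry k X y v → Kry k X′ y′ v′
  Kry-resp zero    hX hy hv h i = ≈-trans (≈-sym (hv i)) (h i)
  Kry-resp (suc k) hX hy hv (c , w , h , eq) = c , w , Kry-resp k hX hy (λ _ → ≈-refl) h ,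
    λ i → ≈-trans (≈-sym (hv i)) (≈-trans (eq i) (+-cong-≈ (*-cong-≈ (≈-refl {x = c}) (hy i)) (∙-cong-≈ {v = w} (hX i) (λ _ → ≈-refl))))

  Kry-≈0 : ∀ {n} k (X : Matℤ n) y {v} → (∀ i → v i ≈ 0ℤ [mod q ]) → Kry k X y v
  Kry-≈0 zero    X y h = h
  Kry-≈0 (suc k) X y h = 0ℤ , (λ _ → 0ℤ) , Kry-≈0 k X y (λ _ → ≈-refl) ,
    λ i → ≈-trans (h i) (≈-sym (+-cong-≈ (≡⇒≈ (ℤₚ.*-zeroˡ (y i))) (∙-zeroʳ-≈ (X i) (λ _ → ≈-refl))))

  Kry-divisible : ∀ {n d} → + d ∣ + q → ∀ k (X : Matℤ n) y → (∀ i → y i ≈ 0ℤ [mod d ]) →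
    ∀ {v} → Kry k X y v → ∀ i → v i ≈ 0ℤ [mod d ]
  Kry-divisible d∣q zero    X y hy h i = ≈-weaken d∣q (h i)
  Kry-divisible d∣q (suc k) X y hy (c , w , h , eq) i = ≈-trans (≈-weaken d∣q (eq i))
    (+-cong-≈ (≈-respʳ (ℤₚ.*-zeroʳ c) (*-cong-≈ (≈-refl {x = c}) (hy i)))
      (∙-zeroʳ-≈ (X i) (Kry-divisible d∣q k X y hy h)))

  -- The entry `u i` is the integer 1, not merely 1 modulo q, so that splitting off u is an identity
  -- between integer vectors. Only the scalar c is a unit modulo q.
  record Pivot {n} (d : ℕ) (y : Vecℤ (suc n)) : Set where
    field
      i        : Fin (suc n)
      u        : Vecℤ (suc n)
      uᵢ≡1     : u i ≡ 1ℤ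
      c c⁻¹    : ℤ
      c*c⁻¹≈1  : c * c⁻¹ ≈ 1ℤ [mod q ]
      y≈dcu    : ∀ j → y j ≈ + d * c * u j [mod q ]
      d∣q      : + d ∣ + q

  module _ {n d} {y : Vecℤ (suc n)} (P : Pivot d y) where
    open Pivot P
    open Reduction i u

    pivot-divides : ∀ j → y j ≈ 0ℤ [mod d ]
    pivot-divides j = ≈-trans (≈-weaken d∣q (y≈dcu j))
      (≈-respˡ (eq (+ d) c (u j)) (multiple-≈0 d (c * u j)))
      where
      eq : ∀ d c u → c * u * d ≡ d * c * u
      eq = solve-∀

    πy≈0 : ∀ j → π y j ≈ 0ℤ [mod q ]
    πy≈0 j = ≈-trans (π-cong-≈ y≈dcu j) (≡⇒≈ (trans (cong (λ z → + d * c * u k - u k * (+ d * c * z)) uᵢ≡1) (eq (+ d) c (u k))))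
      where
      k = punchIn i j
      eq : ∀ d c u → d * c * u - u * (d * c * 1ℤ) ≡ 0ℤ
      eq = solve-∀

    -- Write z i = s d. Then z ≡ z i · u = s · d u ≡ s c⁻¹ · y, the remainder along u being zero
    -- modulo q.
    line : ∀ z → z i ≈ 0ℤ [mod d ] → (∀ j → π z j ≈ 0ℤ [mod q ]) →
      Σ ℤ λ s → ∀ k → z k ≈ s * y k [mod q ]
    line z zᵢ≈0 πz≈0 = s * c⁻¹ , λ k →
      ≈-trans (≡⇒≈ (decompose uᵢ≡1 z k))
        (≈-trans (+-cong-≈ (≈-refl {x = z i * u k}) (tail≈0 k))
          (≈-trans (≡⇒≈ (trans (cong (λ x → x * u k + 0ℤ) (≈0⇒multiple zᵢ≈0)) (eq s (+ d) (u k))))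
            (≈-trans (*-cong-≈ (≈-sym c*c⁻¹≈1) (≈-refl {x = s * + d * u k}))
              (≈-trans (≡⇒≈ (eq′ c c⁻¹ s (+ d) (u k)))
                (*-cong-≈ (≈-refl {x = s * c⁻¹}) (≈-sym (y≈dcu k)))))))
      where
      s = _∣_.quotient (∣diff zᵢ≈0)
      tail≈0 : ∀ k → insertAt (π z) i 0ℤ k ≈ 0ℤ [mod q ]
      tail≈0 = punchIn-elim _ i (≡⇒≈ (insertAt-lookup (π z) i 0ℤ))
        (λ j → ≈-trans (≡⇒≈ (insertAt-punchIn (π z) i 0ℤ j)) (πz≈0 j))
      eq : ∀ s d u → s * d * u + 0ℤ ≡ 1ℤ * (s * d * u)
      eq = solve-∀
      eq′ : ∀ c c′ s d u → c * c′ * (s * d * u) ≡ s * c′ * (d * c * u)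
      eq′ = solve-∀

    module _ (X : Matℤ (suc n)) where

      next-vector : Vecℤ n
      next-vector j = + d * next X j

      π-step : ∀ s v w → (∀ k → v k ≈ s * y k + (X ·v w) k [mod q ]) →
        ∀ j → π v j ≈ w i * next X j + (block X ·v π w) j [mod q ]
      π-step s v w h j = ≈-trans (π-cong-≈ h j)
        (≈-trans (≡⇒≈ (π-linear s y (X ·v w) j))
          (≈-trans (+-cong-≈ (≈-respʳ (ℤₚ.*-zeroʳ s) (*-cong-≈ (≈-refl {x = s}) (πy≈0 j))) (≡⇒≈ (π-·v uᵢ≡1 X w j)))
            (≡⇒≈ (ℤₚ.+-identityˡ _))))

      -- For v = s y + X w the term s y is killed by `π`, leaving w i · `next` + `block` · π w. As w
      -- is itself a Krylov vector, w i is a multiple of d, so the first term is a multiple of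
      -- `next-vector`.
      Kry-reduce : ∀ k v → Kry (suc k) X y v → Kry k (block X) next-vector (π v)
      Kry-reduce zero v (s , w , w≈0 , eq) j = ≈-trans (π-step s v w eq j)
        (+-cong-≈ (≈-respʳ (ℤₚ.*-zeroˡ (next X j)) (*-cong-≈ (w≈0 i) (≈-refl {x = next X j})))
          (∙-zeroʳ-≈ (block X j) (λ l → ≈-trans (π-cong-≈ w≈0 l) (≡⇒≈ (eq₀ (u (punchIn i l)))))))
        where
        eq₀ : ∀ c → 0ℤ - c * 0ℤ ≡ 0ℤ
        eq₀ = solve-∀
      Kry-reduce (suc k) v (s , w , h , eq) = t , π w , Kry-reduce k w h , λ j →
        ≈-trans (π-step s v w eq j)
          (+-cong-≈ (≡⇒≈ (trans (cong (_* next X j) (≈0⇒multiple wᵢ≈0)) (ℤₚ.*-assoc t (+ d) (next X j)))) ≈-refl)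
        where
        wᵢ≈0 : w i ≈ 0ℤ [mod d ]
        wᵢ≈0 = Kry-divisible d∣q (suc k) X y pivot-divides h i
        t = _∣_.quotient (∣diff wᵢ≈0)

      -- Converse by lifting. If π v ≡ s · d · `next` + `block` · w′, the vector w with coordinate s
      -- d at i and projection w′ is Krylov by induction, and π(X w) ≡ π v. Then v - X w has zero
      -- projection and a coordinate at i divisible by d, so `line` makes it a multiple of y.
      Kry-unreduce : ∀ k v → v i ≈ 0ℤ [mod d ] → Kry k (block X) next-vector (π v) → Kry (suc k) X y v
      Kry-unreduce zero v vᵢ≈0 πv≈0 = proj₁ l , (λ _ → 0ℤ) , (λ _ → ≈-refl) , λ k →
        ≈-trans (proj₂ l k) (≈-trans (≡⇒≈ (sym (ℤₚ.+-identityʳ (proj₁ l * y k)))) (+-cong-≈ (≈-refl {x = proj₁ l * y k}) (≈-sym (∙-zeroʳ-≈ (X k) (λ _ → ≈-refl)))))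
        where
        l = line v vᵢ≈0 πv≈0
      Kry-unreduce (suc k) v vᵢ≈0 (s , w′ , h , eq) = proj₁ l , w , Kw , λ j →
        ≈-trans (≡⇒≈ (eq₁ (v j) ((X ·v w) j))) (+-cong-≈ (proj₂ l j) ≈-refl)
        where
        w = lift uᵢ≡1 (s * + d) w′
        Kw : Kry (suc k) X y w
        Kw = Kry-unreduce k w (≈-trans (≡⇒≈ (lift-i uᵢ≡1 (s * + d) w′)) (multiple-≈0 d s))
          (Kry-resp k (λ _ _ → ≈-refl) (λ _ → ≈-refl) (λ j → ≡⇒≈ (sym (π-lift uᵢ≡1 (s * + d) w′ j))) h)
        z : Vecℤ (suc n)
        z j = (- 1ℤ) * (X ·v w) j + v j
        eq₁ : ∀ a b → a ≡ ((- 1ℤ) * b + a) + b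
        eq₁ = solve-∀
        eq₂ : ∀ s d x b → (- 1ℤ) * (s * d * x + b) + (s * (d * x) + b) ≡ 0ℤ
        eq₂ = solve-∀
        zᵢ≈0 : z i ≈ 0ℤ [mod d ]
        zᵢ≈0 = +-cong-≈ (*-cong-≈ (≈-refl {x = - 1ℤ}) (∙-zeroʳ-≈ (X i) (Kry-divisible d∣q (suc k) X y pivot-divides Kw))) vᵢ≈0
        πXw : ∀ j → π (X ·v w) j ≈ s * + d * next X j + (block X ·v w′) j [mod q ]
        πXw j = ≈-trans (≡⇒≈ (π-·v uᵢ≡1 X w j))
          (+-cong-≈ (≡⇒≈ (cong (_* next X j) (lift-i uᵢ≡1 (s * + d) w′)))
            (∙-cong-≈ {r = block X j} (λ _ → ≈-refl) (λ l → ≡⇒≈ (π-lift uᵢ≡1 (s * + d) w′ l))))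
        πz≈0 : ∀ j → π z j ≈ 0ℤ [mod q ]
        πz≈0 j = ≈-trans (≡⇒≈ (π-linear (- 1ℤ) (X ·v w) v j))
          (≈-trans (+-cong-≈ (*-cong-≈ (≈-refl {x = - 1ℤ}) (πXw j)) (eq j))
            (≡⇒≈ (eq₂ s (+ d) (next X j) ((block X ·v w′) j))))
        l = line z zᵢ≈0 πz≈0

-- Finite abelian p-groups and their exponents

residues-≈⇒≡ : ∀ {d a b} → a < d → b < d → + a ≈ + b [mod d ] → a ≡ b
residues-≈⇒≡ {d} {a} {b} a<d b<d ⟪ d∣ ⟫ = ℤₚ.+-injective (ℤₚ.i-j≡0⇒i≡j (+ a) (+ b) (ℤₚ.∣i∣≡0⇒i≡0 (small _ r<d (∣⇒∣ᵤ d∣))))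
  where
  r<d : ℤ.∣ + a - + b ∣ < d
  r<d = subst (_< d) (cong ℤ.∣_∣ (sym (ℤₚ.[+m]-[+n]≡m⊖n a b)))
    (ℕₚ.≤-<-trans (ℤₚ.∣m⊝n∣≤m⊔n a b) (ℕₚ.⊔-lub a<d b<d))
  small : ∀ r → r < d → d ℕ∣.∣ r → r ≡ 0
  small zero    _   _  = refl
  small (suc r) r<d d∣r = contradiction d∣r (ℕ∣.>⇒∤ r<d)

≈-residue : ∀ x d .{{_ : NonZero d}} → x ≈ + (x %ℕ d) [mod d ]
≈-residue x d = ⟪ divides (x /ℕ d) (trans (cong (_- + (x %ℕ d)) (a≡a%ℕn+[a/ℕn]*n x d)) (eq (+ (x %ℕ d)) (x /ℕ d * + d))) ⟫
  where
  eq : ∀ a b → a + b - a ≡ b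
  eq = solve-∀

-- Recovering a nondecreasing list from truncated totals

total : ∀ {n} → (Fin n → ℕ) → ℕ
total {zero}  e = 0
total {suc n} e = e zero ℕ.+ total (e ∘ suc)

NonDecreasing : ∀ {n} → (Fin n → ℕ) → Set
NonDecreasing {zero}  e = ⊤
NonDecreasing {suc n} e = (∀ i → e zero ≤ e (suc i)) × NonDecreasing (e ∘ suc)

total-⊓-≤ : ∀ {n} (e : Fin n → ℕ) j → total (λ i → e i ⊓ j) ≤ n ℕ.* j
total-⊓-≤ {zero}  e j = ℕ.z≤n
total-⊓-≤ {suc n} e j = ℕₚ.+-mono-≤ (ℕₚ.m⊓n≤n (e zero) j) (total-⊓-≤ (e ∘ suc) j)

total-⊓-≡ : ∀ {n} (e : Fin n → ℕ) j → (∀ i → j ≤ e i) → total (λ i → e i ⊓ j) ≡ n ℕ.* j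
total-⊓-≡ {zero}  e j h = refl
total-⊓-≡ {suc n} e j h = cong₂ ℕ._+_ (ℕₚ.m≥n⇒m⊓n≡n (h zero)) (total-⊓-≡ (e ∘ suc) j (h ∘ suc))

-- Test with j = `e′ zero`. Every part of e′ is at least j, so the total for e′ is the largest
-- possible, (n + 1) j; a first part of e below j would make the other total smaller.
head-≤ : ∀ {n} (e e′ : Fin (suc n) → ℕ) → NonDecreasing e′ →
  (∀ j → total (λ i → e i ⊓ j) ≡ total (λ i → e′ i ⊓ j)) → e′ zero ≤ e zero
head-≤ {n} e e′ (h , _) eq = ℕₚ.≮⇒≥ λ e₀<e₀′ → ℕₚ.<-irrefl (eq (e′ zero)) (begin-strict
  total (λ i → e i ⊓ e′ zero)        ≤⟨ ℕₚ.+-mono-≤ (ℕₚ.m⊓n≤m (e zero) (e′ zero)) (total-⊓-≤ (e ∘ suc) (e′ zero)) ⟩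
  e zero ℕ.+ n ℕ.* e′ zero           <⟨ ℕₚ.+-monoˡ-< (n ℕ.* e′ zero) e₀<e₀′ ⟩
  suc n ℕ.* e′ zero                  ≡⟨ total-⊓-≡ e′ (e′ zero) (λ { zero → ℕₚ.≤-refl ; (suc i) → h i }) ⟨
  total (λ i → e′ i ⊓ e′ zero)       ∎)
  where open ℕₚ.≤-Reasoning

-- For G = ⊕ ℤ/p^(eᵢ) the total of `e i ⊓ j` is the exponent of p in the order of G / pʲG. These
-- numbers give the smallest part, whose contribution is then cancelled.
total-⊓-injective : ∀ {n} (e e′ : Fin n → ℕ) → NonDecreasing e → NonDecreasing e′ →
  (∀ j → total (λ i → e i ⊓ j) ≡ total (λ i → e′ i ⊓ j)) → e ≗ e′
total-⊓-injective {suc n} e e′ (h , s) (h′ , s′) eq = λ { zero → e₀≡e₀′ ; (suc i) → tails i }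
  where
  e₀≡e₀′ : e zero ≡ e′ zero
  e₀≡e₀′ = ℕₚ.≤-antisym (head-≤ e′ e (h , s) (sym ∘ eq)) (head-≤ e e′ (h′ , s′) eq)
  tails : e ∘ suc ≗ e′ ∘ suc
  tails = total-⊓-injective (e ∘ suc) (e′ ∘ suc) s s′ λ j →
    ℕₚ.+-cancelˡ-≡ (e zero ⊓ j) _ _ (trans (eq j) (cong (λ x → x ⊓ j ℕ.+ _) (sym e₀≡e₀′)))

module DirectSums (p : ℕ) (1<p : 1 < p) where

  instance
    p≢0 : NonZero p
    p≢0 = ℕ.>-nonZero (ℕₚ.<-trans ℕ.z<s 1<p)

  p^-mono⁻¹ : ∀ {a b} → p ^ a ≤ p ^ b → a ≤ b
  p^-mono⁻¹ {a} {b} h = ℕₚ.≮⇒≥ λ b<a → ℕₚ.<⇒≱ (ℕₚ.^-monoʳ-< p 1<p b<a) h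

  p^-∣ : ∀ {a b} → a ≤ b → + (p ^ a) ∣ + (p ^ b)
  p^-∣ {a} {b} a≤b = divides (+ (p ^ (b ℕ.∸ a))) (trans
    (cong +_ (trans (cong (p ^_) (sym (ℕₚ.m∸n+n≡m a≤b))) (ℕₚ.^-distribˡ-+-* p (b ℕ.∸ a) a)))
    (ℤₚ.pos-* (p ^ (b ℕ.∸ a)) (p ^ a)))

  DirectSum : ∀ {n} → (Fin n → ℕ) → Vecℤ n → Vecℤ n → Set
  DirectSum e v w = ∀ i → v i ≈ w i [mod p ^ e i ]

  DirectSum-resp : ∀ {n} {e e′ : Fin n → ℕ} → e ≗ e′ → ∀ {v w} → DirectSum e v w → DirectSum e′ v w
  DirectSum-resp eq {v} {w} h i = subst (λ k → v i ≈ w i [mod p ^ k ]) (eq i) (h i)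

  -- A section of f chosen by surjectivity. R is an arbitrary relation, so every comparison is made
  -- in the direct sum and carried back to R by injectivity.
  QuotIso-inverse : ∀ {n k} {R : Vecℤ n → Vecℤ n → Set} {e : Fin k → ℕ} →
    QuotIso n k R (DirectSum e) → QuotIso k n (DirectSum e) R
  QuotIso-inverse {n} {k} {R} {e} (f , resp , add , inj , surj) =
    g , (λ y y′ h → inj _ _ (λ i → ≈-trans (fg y i) (≈-trans (h i) (≈-sym (fg y′ i))))) ,
    (λ y y′ → inj _ _ (λ i → ≈-trans (fg (y +v y′) i)
       (≈-trans (≈-sym (+-cong-≈ (fg y i) (fg y′ i))) (≈-sym (add (g y) (g y′) i))))) ,
    (λ y y′ h i → ≈-trans (≈-sym (fg y i)) (≈-trans (resp _ _ h i) (fg y′ i))) ,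
    (λ v → f v , inj _ _ (fg (f v)))
    where
    g : Vecℤ k → Vecℤ n
    g y = proj₁ (surj y)
    fg : ∀ y → DirectSum e (f (g y)) y
    fg y = proj₂ (surj y)

  QuotIso-compose : ∀ {a b c} {R : Vecℤ a → Vecℤ a → Set} {S : Vecℤ b → Vecℤ b → Set} {e : Fin c → ℕ} →
    QuotIso a b R S → QuotIso b c S (DirectSum e) → QuotIso a c R (DirectSum e)
  QuotIso-compose (f , resp , add , inj , surj) (f′ , resp′ , add′ , inj′ , surj′) =
    f′ ∘ f , (λ v w h → resp′ _ _ (resp v w h)) ,
    (λ v w i → ≈-trans (resp′ _ _ (add v w) i) (add′ (f v) (f w) i)) ,
    (λ v w h → inj v w (inj′ _ _ h)) ,
    (λ y → let s , fs = surj′ y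
               v , fv = surj s
           in v , λ i → ≈-trans (resp′ _ _ fv i) (fs i))

  module _ {n k} {e : Fin n → ℕ} {e′ : Fin k → ℕ} (iso : QuotIso n k (DirectSum e) (DirectSum e′)) where
    private
      f = proj₁ iso
      resp = proj₁ (proj₂ iso)
      add = proj₁ (proj₂ (proj₂ iso))

    -- Additivity holds only modulo the target congruence: f v ≡ f (v + v) ≡ f v + f v, and f v is
    -- subtracted.
    QuotIso-zero : ∀ v → (∀ i → v i ≡ 0ℤ) → ∀ i → f v i ≈ 0ℤ [mod p ^ e′ i ]
    QuotIso-zero v v≡0 i = ≈-trans (≡⇒≈ (eq (f v i))) (≈-trans (minus-cong-≈ (≈-sym f-double) ≈-refl) (≡⇒≈ (ℤₚ.+-inverseʳ (f v i))))
      where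
      eq : ∀ x → x ≡ (x + x) - x
      eq = solve-∀
      v≈v+v : DirectSum e v (v +v v)
      v≈v+v l = ≡⇒≈ (trans (v≡0 l) (sym (cong₂ _+_ (v≡0 l) (v≡0 l))))
      f-double : f v i ≈ f v i + f v i [mod p ^ e′ i ]
      f-double = ≈-trans (resp _ _ v≈v+v i) (add v v i)

    QuotIso-multiple : ∀ N t i → f (λ l → + N * t l) i ≈ + N * f t i [mod p ^ e′ i ]
    QuotIso-multiple zero t i = ≈-trans (QuotIso-zero _ (λ l → ℤₚ.*-zeroˡ (t l)) i) (≡⇒≈ (sym (ℤₚ.*-zeroˡ (f t i))))
    QuotIso-multiple (suc N) t i = ≈-trans (resp _ _ (λ l → ≡⇒≈ (suc-* (t l))) i)
      (≈-trans (add t (λ l → + N * t l) i)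
        (≈-trans (+-cong-≈ (≈-refl {x = f t i}) (QuotIso-multiple N t i)) (≡⇒≈ (sym (suc-* (f t i))))))
      where
      suc-* : ∀ x → + suc N * x ≡ x + + N * x
      suc-* x = ℤₚ.suc-* (+ N) x

    -- Reducing the exponents to e ⊓ j presents the quotient modulo p ^ j.
    QuotIso-⊓ : ∀ j v w → DirectSum (λ i → e i ⊓ j) v w → DirectSum (λ i → e′ i ⊓ j) (f v) (f w)
    QuotIso-⊓ j v w h i = ≈-trans (weakenˡ f-shift)
      (≈-trans (+-cong-≈ (≈-refl {x = f w i})
          (≈-weaken (p^-∣ (ℕₚ.m⊓n≤n (e′ i) j)) (≈-respˡ (ℤₚ.*-comm (f t i) (+ (p ^ j))) (multiple-≈0 (p ^ j) (f t i)))))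
        (≡⇒≈ (ℤₚ.+-identityʳ (f w i))))
      where
      -- A congruence modulo p ^ (e l ⊓ j) is one modulo p ^ e l up to a multiple of p ^ j. Since f
      -- is additive, that correction becomes p ^ j times a value of f.
      shift : ∀ l → Σ ℤ λ s → v l ≈ w l + + (p ^ j) * s [mod p ^ e l ]
      shift l with e l ℕ.≤? j
      ... | yes e≤j = 0ℤ , ≈-trans (subst (λ x → v l ≈ w l [mod p ^ x ]) (ℕₚ.m≤n⇒m⊓n≡m e≤j) (h l)) (≡⇒≈ (eq (w l) (+ (p ^ j))))
        where
        eq : ∀ a b → a ≡ a + b * 0ℤ
        eq = solve-∀
      ... | no e≰j with subst (λ x → v l ≈ w l [mod p ^ x ]) (ℕₚ.m≥n⇒m⊓n≡n (ℕₚ.<⇒≤ (ℕₚ.≰⇒> e≰j))) (h l)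
      ...   | ⟪ divides s v-w≡s*p^j ⟫ = s , ≡⇒≈ (trans (eq (v l) (w l)) (cong₂ _+_ {x = w l} refl (trans v-w≡s*p^j (ℤₚ.*-comm s _))))
        where
        eq : ∀ a b → a ≡ b + (a - b)
        eq = solve-∀
      t : Vecℤ n
      t = proj₁ ∘ shift
      weakenˡ : ∀ {x y} → x ≈ y [mod p ^ e′ i ] → x ≈ y [mod p ^ (e′ i ⊓ j) ]
      weakenˡ = ≈-weaken (p^-∣ (ℕₚ.m⊓n≤m (e′ i) j))
      f-shift : f v i ≈ f w i + + (p ^ j) * f t i [mod p ^ e′ i ]
      f-shift = ≈-trans (resp _ _ (proj₂ ∘ shift) i)
        (≈-trans (add w (λ l → + (p ^ j) * t l) i) (+-cong-≈ (≈-refl {x = f w i}) (QuotIso-multiple (p ^ j) t i)))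

  -- The order of the direct sum, as a nested product so that `combine` and `remQuot` number the
  -- classes coordinate by coordinate.
  size : ∀ {n} → (Fin n → ℕ) → ℕ
  size {zero}  e = 1
  size {suc n} e = p ^ e zero ℕ.* size (e ∘ suc)

  size≡p^total : ∀ {n} (e : Fin n → ℕ) → size e ≡ p ^ total e
  size≡p^total {zero}  e = refl
  size≡p^total {suc n} e = trans (cong (p ^ e zero ℕ.*_) (size≡p^total (e ∘ suc)))
    (sym (ℕₚ.^-distribˡ-+-* p (e zero) (total (e ∘ suc))))

  residue : ∀ k → ℤ → Fin (p ^ k)
  residue k x = fromℕ< (n%ℕd<d x (p ^ k))
    where instance _ = ℕₚ.m^n≢0 p k

  residue-injective : ∀ k x y → residue k x ≡ residue k y → x ≈ y [mod p ^ k ]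
  residue-injective k x y eq = ≈-trans (≈-residue x (p ^ k))
    (≈-trans (≡⇒≈ (cong +_ (Finₚ.fromℕ<-injective _ _ (n%ℕd<d x (p ^ k)) (n%ℕd<d y (p ^ k)) eq))) (≈-sym (≈-residue y (p ^ k))))
    where instance _ = ℕₚ.m^n≢0 p k

  encode : ∀ {n} (e : Fin n → ℕ) → Vecℤ n → Fin (size e)
  encode {zero}  e v = zero
  encode {suc n} e v = combine (residue (e zero) (v zero)) (encode (e ∘ suc) (v ∘ suc))

  encode-injective : ∀ {n} (e : Fin n → ℕ) v w → encode e v ≡ encode e w → DirectSum e v w
  encode-injective {suc n} e v w eq = λ
    { zero    → residue-injective (e zero) (v zero) (w zero) (Finₚ.combine-injectiveˡ _ (encode (e ∘ suc) (v ∘ suc)) _ (encode (e ∘ suc) (w ∘ suc)) eq)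
    ; (suc i) → encode-injective (e ∘ suc) (v ∘ suc) (w ∘ suc)
        (Finₚ.combine-injectiveʳ (residue (e zero) (v zero)) _ (residue (e zero) (w zero)) _ eq) i
    }

  decode : ∀ {n} (e : Fin n → ℕ) → Fin (size e) → Vecℤ n
  decode {suc n} e x zero    = + toℕ (proj₁ (remQuot {p ^ e zero} (size (e ∘ suc)) x))
  decode {suc n} e x (suc i) = decode (e ∘ suc) (proj₂ (remQuot {p ^ e zero} (size (e ∘ suc)) x)) i

  decode-injective : ∀ {n} (e : Fin n → ℕ) x y → DirectSum e (decode e x) (decode e y) → x ≡ y
  decode-injective {zero}  e zero zero h = refl
  decode-injective {suc n} e x y h = begin
    x                                       ≡⟨ Finₚ.combine-remQuot {p ^ e zero} (size (e ∘ suc)) x ⟨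
    combine (proj₁ (rq x)) (proj₂ (rq x))   ≡⟨ cong₂ combine
                                                 (Finₚ.toℕ-injective (residues-≈⇒≡ (Finₚ.toℕ<n (proj₁ (rq x))) (Finₚ.toℕ<n (proj₁ (rq y))) (h zero)))
                                                 (decode-injective (e ∘ suc) _ _ (h ∘ suc)) ⟩
    combine (proj₁ (rq y)) (proj₂ (rq y))   ≡⟨ Finₚ.combine-remQuot {p ^ e zero} (size (e ∘ suc)) y ⟩
    y                                       ∎
    where
    open ≡-Reasoning
    rq : Fin (size e) → Fin (p ^ e zero) × Fin (size (e ∘ suc))
    rq = remQuot {p ^ e zero} (size (e ∘ suc))

  -- Pigeonhole: taking a representative, applying f and numbering the resulting class injects p ^
  -- `total e` classes into p ^ `total e′` classes.
  reflecting⇒total-≤ : ∀ {n k} (e : Fin n → ℕ) (e′ : Fin k → ℕ) (f : Vecℤ n → Vecℤ k) →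
    (∀ v w → DirectSum e′ (f v) (f w) → DirectSum e v w) → total e ≤ total e′
  reflecting⇒total-≤ e e′ f inj = p^-mono⁻¹ (subst₂≤ (size≡p^total e) (size≡p^total e′)
    (Finₚ.injective⇒≤ {f = encode e′ ∘ f ∘ decode e} λ {x} {y} eq → decode-injective e x y (inj _ _ (encode-injective e′ _ _ eq))))
    where
    subst₂≤ : ∀ {a b c d} → a ≡ c → b ≡ d → a ≤ b → c ≤ d
    subst₂≤ refl refl h = h

  -- The map f reflects the congruences with exponents cut off at j because its inverse respects
  -- them, so the orders of the quotients modulo p ^ j can be compared.
  QuotIso⇒total-⊓-≤ : ∀ {n k} {e : Fin n → ℕ} {e′ : Fin k → ℕ} → QuotIso n k (DirectSum e) (DirectSum e′) →
    ∀ j → total (λ i → e i ⊓ j) ≤ total (λ i → e′ i ⊓ j)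
  QuotIso⇒total-⊓-≤ {e = e} {e′} iso@(f , _) j = reflecting⇒total-≤ _ _ f λ v w h i →
    ≈-trans (≈-sym (gf v i)) (≈-trans (QuotIso-⊓ {e = e′} {e} iso⁻¹ j (f v) (f w) h i) (gf w i))
    where
    iso⁻¹ = QuotIso-inverse {e = e′} iso
    g = proj₁ iso⁻¹
    gf : ∀ v → DirectSum (λ i → e i ⊓ j) (g (f v)) v
    gf v i = ≈-weaken (p^-∣ (ℕₚ.m⊓n≤m (e i) j)) (proj₂ (proj₂ (proj₂ (proj₂ (proj₂ iso⁻¹))) v) i)

  DirectSum-unique : ∀ {n} {e e′ : Fin n → ℕ} → NonDecreasing e → NonDecreasing e′ →
    QuotIso n n (DirectSum e) (DirectSum e′) → e ≗ e′
  DirectSum-unique {e = e} {e′} s s′ iso = total-⊓-injective e e′ s s′ λ j →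
    ℕₚ.≤-antisym (QuotIso⇒total-⊓-≤ {e = e} {e′} iso j) (QuotIso⇒total-⊓-≤ {e = e′} {e} (QuotIso-inverse {e = e′} iso) j)

infix 4 _≈?_[mod_]
_≈?_[mod_] : ∀ x y d → Dec (x ≈ y [mod d ])
x ≈? y [mod d ] = map′ ⟪_⟫ ∣diff (+ d ∣? x - y)

-- Exponents of the cokernel

≈-mod-1 : ∀ x y → x ≈ y [mod 1 ]
≈-mod-1 x y = ⟪ divides (x - y) (sym (ℤₚ.*-identityʳ (x - y))) ⟫

module CokernelTypes (p : ℕ) (prime : Prime p) (m : ℕ) where

  1<p : 1 < p
  1<p = ℕ.nonTrivial⇒n>1 p {{prime⇒nonTrivial prime}}

  open DirectSums p 1<p public
  open Krylov (p ^ m) public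

  -- Bézout for p and the absolute value of z, coprime because p is prime; the sign of z is restored
  -- afterwards.
  unit-mod-p : ∀ z → ¬ (z ≈ 0ℤ [mod p ]) → Σ ℤ λ x → z * x ≈ 1ℤ [mod p ]
  unit-mod-p z z≉0 = signed (ℤₚ.+∣i∣≡i⊎+∣i∣≡-i z)
    where
    a = ℤ.∣ z ∣
    coprime : Coprime p a
    coprime {d} (d∣p , d∣a) with prime⇒irreducible prime d∣p
    ... | inj₁ d≡1  = d≡1
    ... | inj₂ refl = contradiction (-≈0⇒≈ ⟪ subst (+ p ∣_) (sym (trans (ℤₚ.+-identityʳ _) (ℤₚ.+-identityʳ z))) (∣ᵤ⇒∣ d∣a) ⟫) z≉0
    pos-identity : ∀ x y u w → 1 ℕ.+ x ℕ.* y ≡ u ℕ.* w → 1ℤ + + x * + y ≡ + u * + w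
    pos-identity x y u w h = trans (cong (λ t → 1ℤ + t) (sym (ℤₚ.pos-* x y))) (trans (sym (ℤₚ.pos-+ 1 (x ℕ.* y))) (trans (cong +_ h) (ℤₚ.pos-* u w)))
    unsigned : Σ ℤ λ x → + a * x ≈ 1ℤ [mod p ]
    unsigned with coprime-Bézout coprime
    ... | Bézout.+- x y h = - + y , ⟪ divides (- + x) (trans (eq (+ a) (+ y)) (trans (cong -_ (pos-identity y a x p h)) (ℤₚ.neg-distribˡ-* (+ x) (+ p)))) ⟫
      where
      eq : ∀ a y → a * (- y) - 1ℤ ≡ - (1ℤ + y * a)
      eq = solve-∀
    ... | Bézout.-+ x y h = + y , ⟪ divides (+ x) (trans (cong (_- 1ℤ) (trans (ℤₚ.*-comm (+ a) (+ y)) (sym (pos-identity x p y a h)))) (eq (+ x * + p))) ⟫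
      where
      eq : ∀ t → 1ℤ + t - 1ℤ ≡ t
      eq = solve-∀
    signed : _ → Σ ℤ λ x → z * x ≈ 1ℤ [mod p ]
    signed (inj₁ a≡z)  = proj₁ unsigned , ≈-respˡ (cong (_* proj₁ unsigned) a≡z) (proj₂ unsigned)
    signed (inj₂ a≡-z) = - proj₁ unsigned , ≈-respˡ (trans (cong (_* proj₁ unsigned) a≡-z) (eq z (proj₁ unsigned))) (proj₂ unsigned)
      where
      eq : ∀ z x → (- z) * x ≡ z * (- x)
      eq = solve-∀

  -- Hensel lifting: if z c = 1 + s pᵏ and z x = 1 + t p, replacing c by c - s pᵏ x turns the error
  -- into - s t pᵏ⁺¹.
  unit-mod-p^ : ∀ z → ¬ (z ≈ 0ℤ [mod p ]) → ∀ k → Σ ℤ λ x → z * x ≈ 1ℤ [mod p ^ k ]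
  unit-mod-p^ z z≉0 zero    = 0ℤ , ≈-mod-1 _ _
  unit-mod-p^ z z≉0 (suc k) with unit-mod-p z z≉0 | unit-mod-p^ z z≉0 k
  ... | x , ⟪ divides t zx-1≡tp ⟫ | c , ⟪ divides s zc-1≡sp^k ⟫ = c - s * + (p ^ k) * x , ⟪ divides (- (s * t)) (begin
    z * (c - s * + (p ^ k) * x) - 1ℤ                        ≡⟨ eq₁ z c (s * + (p ^ k)) x ⟩
    (z * c - 1ℤ) - s * + (p ^ k) * (z * x)                  ≡⟨ cong (_- s * + (p ^ k) * (z * x)) zc-1≡sp^k ⟩
    s * + (p ^ k) - s * + (p ^ k) * (z * x)                 ≡⟨ eq₂ s (+ (p ^ k)) (z * x) ⟩
    - (s * + (p ^ k) * (z * x - 1ℤ))                        ≡⟨ cong (λ y → - (s * + (p ^ k) * y)) zx-1≡tp ⟩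
    - (s * + (p ^ k) * (t * + p))                           ≡⟨ eq₃ s (+ (p ^ k)) t (+ p) ⟩
    - (s * t) * (+ p * + (p ^ k))                           ≡⟨ cong (- (s * t) *_) (sym (ℤₚ.pos-* p (p ^ k))) ⟩
    - (s * t) * + (p ^ suc k)                               ∎) ⟫
    where
    open ≡-Reasoning
    eq₁ : ∀ z c r x → z * (c - r * x) - 1ℤ ≡ (z * c - 1ℤ) - r * (z * x)
    eq₁ = solve-∀
    eq₂ : ∀ s r y → s * r - s * r * y ≡ - (s * r * (y - 1ℤ))
    eq₂ = solve-∀
    eq₃ : ∀ s r t p → - (s * r * (t * p)) ≡ - (s * t) * (p * r)
    eq₃ = solve-∀

  -- Valuations and pivots

  Divisible : ∀ {n} → ℕ → Vecℤ n → Set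
  Divisible a y = ∀ j → y j ≈ 0ℤ [mod p ^ a ]

  abstract
    divisible? : ∀ {n} a (y : Vecℤ n) → Dec (Divisible a y)
    divisible? a y = Finₚ.all? (λ j → y j ≈? 0ℤ [mod p ^ a ])

  Divisible-weaken : ∀ {n a b} {y : Vecℤ n} → a ≤ b → Divisible b y → Divisible a y
  Divisible-weaken a≤b h j = ≈-weaken (p^-∣ a≤b) (h j)

  -- The p-adic valuation of y, capped at m.
  record Valuation {n} (y : Vecℤ n) (a : ℕ) : Set where
    field
      a≤m       : a ≤ m
      divisible : Divisible a y
      maximal   : a < m → ¬ Divisible (suc a) y
  open Valuation public

  Valuation-≤ : ∀ {n} {y : Vecℤ n} {a b} → Valuation y b → a ≤ m → Divisible a y → a ≤ b
  Valuation-≤ V a≤m h = ℕₚ.≮⇒≥ λ b<a → maximal V (ℕₚ.<-≤-trans b<a a≤m) (Divisible-weaken b<a h)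

  findPivot : ∀ {n} (y : Vecℤ (suc n)) → Σ ℕ λ a → Valuation y a × Pivot (p ^ a) y
  findPivot {n} y = search m 0 refl (λ j → ≈-mod-1 (y j) 0ℤ)
    where
    search : ∀ fuel a → a ℕ.+ fuel ≡ m → Divisible a y → Σ ℕ λ a → Valuation y a × Pivot (p ^ a) y
    search zero a a+0≡m h = a , record { a≤m = ℕₚ.≤-reflexive a≡m ; divisible = h ; maximal = λ a<m → contradiction a≡m (ℕₚ.<⇒≢ a<m) } ,
      record
        -- Here y and p ^ a both vanish modulo p ^ m, so any u with an entry 1 serves.
        { i = zero ; u = λ _ → 1ℤ ; uᵢ≡1 = refl ; c = 1ℤ ; c⁻¹ = 1ℤ ; c*c⁻¹≈1 = ≈-refl
        ; y≈dcu = λ j → ≈-trans (subst (λ k → y j ≈ 0ℤ [mod p ^ k ]) a≡m (h j))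
            (≈-trans (≈-sym (subst (λ k → + (p ^ k) ≈ 0ℤ [mod p ^ m ]) (sym a≡m) (≈-respˡ (ℤₚ.*-identityˡ (+ (p ^ m))) (multiple-≈0 (p ^ m) 1ℤ)))) (≡⇒≈ (eq (+ (p ^ a)))))
        ; d∣q = p^-∣ (ℕₚ.≤-reflexive a≡m)
        }
      where
      a≡m : a ≡ m
      a≡m = trans (sym (ℕₚ.+-identityʳ a)) a+0≡m
      eq : ∀ x → x ≡ x * 1ℤ * 1ℤ
      eq = solve-∀
    search (suc fuel) a a+f≡m h with divisible? (suc a) y
    ... | yes h′ = search fuel (suc a) (trans (sym (ℕₚ.+-suc a fuel)) a+f≡m) h′
    ... | no ¬h′ = a , record { a≤m = a≤m′ ; divisible = h ; maximal = λ _ → ¬h′ } ,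
      record
        { i = i ; u = u ; uᵢ≡1 = uᵢ≡1 ; c = z i ; c⁻¹ = c⁻¹ ; c*c⁻¹≈1 = proj₂ inv
        ; y≈dcu = y≈dcu ; d∣q = p^-∣ a≤m′ }
      where
      a≤m′ : a ≤ m
      a≤m′ = ℕₚ.m+n≤o⇒m≤o a (ℕₚ.≤-reflexive a+f≡m)
      z : Vecℤ (suc n)
      z j = _∣_.quotient (∣diff (h j))
      y≡zp^a : ∀ j → y j ≡ z j * + (p ^ a)
      y≡zp^a j = ≈0⇒multiple (h j)
      witness = Finₚ.¬∀⟶∃¬ (suc n) _ (λ j → y j ≈? 0ℤ [mod p ^ suc a ]) ¬h′
      i = proj₁ witness
      zᵢ≉0 : ¬ (z i ≈ 0ℤ [mod p ])
      zᵢ≉0 zᵢ≈0 = proj₂ witness (≈-respˡ (sym eq) (multiple-≈0 (p ^ suc a) s))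
        where
        s = _∣_.quotient (∣diff zᵢ≈0)
        eq : y i ≡ s * + (p ^ suc a)
        eq = trans (y≡zp^a i) (trans (cong (_* + (p ^ a)) (≈0⇒multiple zᵢ≈0))
          (trans (ℤₚ.*-assoc s (+ p) (+ (p ^ a))) (cong (s *_) (sym (ℤₚ.pos-* p (p ^ a))))))
      inv = unit-mod-p^ (z i) zᵢ≉0 m
      c⁻¹ = proj₁ inv
      -- The entry z i is prime to p, hence a unit, and u is z divided by it. As c⁻¹ * z i is only
      -- congruent to 1, the entry at i is set to 1 itself.
      u : Vecℤ (suc n)
      u j with i ≟ j
      ... | yes _ = 1ℤ
      ... | no _  = c⁻¹ * z j
      uᵢ≡1 : u i ≡ 1ℤ
      uᵢ≡1 with i ≟ i
      ... | yes _ = refl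
      ... | no i≢i = contradiction refl i≢i
      y≈dcu : ∀ j → y j ≈ + (p ^ a) * z i * u j [mod p ^ m ]
      y≈dcu j with i ≟ j
      ... | yes refl = ≡⇒≈ (trans (y≡zp^a i) (eq (z i) (+ (p ^ a))))
        where
        eq : ∀ z r → z * r ≡ r * z * 1ℤ
        eq = solve-∀
      ... | no _ = ≈-trans (≡⇒≈ (trans (y≡zp^a j) (eq (z j * + (p ^ a)))))
        (≈-trans (*-cong-≈ (≈-sym (proj₂ inv)) (≈-refl {x = z j * + (p ^ a)})) (≡⇒≈ (eq′ (z i) c⁻¹ (z j) (+ (p ^ a)))))
        where
        eq : ∀ x → x ≡ 1ℤ * x
        eq = solve-∀
        eq′ : ∀ c c′ z r → c * c′ * (z * r) ≡ r * c * (c′ * z)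
        eq′ = solve-∀

  abstract
    pivot : ∀ {n} (y : Vecℤ (suc n)) → Σ ℕ λ a → Valuation y a × Pivot (p ^ a) y
    pivot = findPivot

  Coker : ∀ {n} → Matℤ n → Vecℤ n → Vecℤ n → Vecℤ n → Set
  Coker {n} X y v w = Kry n X y (λ i → v i - w i)

  HasType : ∀ {n} → (Fin n → ℕ) → Matℤ n → Vecℤ n → Set
  HasType {n} e X y = QuotIso n n (Coker X y) (DirectSum e)

  QuotIso-resp : ∀ {n k} {R R′ : Vecℤ n → Vecℤ n → Set} {S S′ : Vecℤ k → Vecℤ k → Set} →
    (∀ v w → R v w → R′ v w) → (∀ v w → R′ v w → R v w) → (∀ v w → S v w → S′ v w) → (∀ v w → S′ v w → S v w) →
    QuotIso n k R S → QuotIso n k R′ S′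
  QuotIso-resp r r⁻¹ s s⁻¹ (f , resp , add , inj , surj) =
    f , (λ v w h → s _ _ (resp v w (r⁻¹ v w h))) , (λ v w → s _ _ (add v w)) ,
    (λ v w h → r v w (inj v w (s⁻¹ _ _ h))) , (λ y → proj₁ (surj y) , s _ _ (proj₂ (surj y)))

  HasType-resp : ∀ {n} {e e′ : Fin n → ℕ} {X X′ : Matℤ n} {y y′} → e ≗ e′ →
    (∀ i → X i ≋ X′ i [mod p ^ m ]) → y ≋ y′ [mod p ^ m ] → HasType e X y → HasType e′ X′ y′
  HasType-resp {n} eq hX hy = QuotIso-resp
    (λ _ _ → Kry-resp n hX hy (λ _ → ≈-refl))
    (λ _ _ → Kry-resp n (λ i j → ≈-sym (hX i j)) (λ i → ≈-sym (hy i)) (λ _ → ≈-refl))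
    (λ v w → DirectSum-resp eq {v} {w}) (λ v w → DirectSum-resp (λ i → sym (eq i)) {v} {w})

  -- The isomorphism sends v to (v i , f (π v)). Its kernel consists of the v with p ^ a dividing v
  -- i and π v in the reduced Krylov module, which `Kry-reduce` and `Kry-unreduce` identify with the
  -- Krylov module of y.
  HasType-∷ : ∀ {n a} {e : Fin n → ℕ} {y : Vecℤ (suc n)} (P : Pivot (p ^ a) y) (X : Matℤ (suc n)) →
    HasType e (Reduction.block (Pivot.i P) (Pivot.u P) X) (next-vector P X) → HasType (a ∷ᶠ e) X y
  HasType-∷ {n} {a} {e} {y} P X (f , resp , add , inj , surj) = g , g-resp , g-add , g-inj , g-surj
    where
    open Pivot P
    open Reduction i u
    B = block X
    y′ = next-vector P X
    g : Vecℤ (suc n) → Vecℤ (suc n)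
    g v = v i ∷ᶠ f (π v)
    minus : ∀ {k} → Vecℤ k → Vecℤ k → Vecℤ k
    minus v w l = v l - w l
    π-minus : ∀ v w j → π (minus v w) j ≡ minus (π v) (π w) j
    π-minus v w j = eq (v (punchIn i j)) (w (punchIn i j)) (u (punchIn i j)) (v i) (w i)
      where
      eq : ∀ a b c x y → (a - b) - c * (x - y) ≡ (a - c * x) - (b - c * y)
      eq = solve-∀
    π-+ : ∀ v w j → π (v +v w) j ≡ (π v +v π w) j
    π-+ v w j = eq (v (punchIn i j)) (w (punchIn i j)) (u (punchIn i j)) (v i) (w i)
      where
      eq : ∀ a b c x y → (a + b) - c * (x + y) ≡ (a - c * x) + (b - c * y)
      eq = solve-∀
    ≗⇒Coker : ∀ {v w} → v ≗ w → Coker B y′ v w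
    ≗⇒Coker {v} {w} eq = Kry-≈0 n B y′ (λ l → ≈⇒-≈0 (≡⇒≈ (eq l)))
    g-resp : ∀ v w → Coker X y v w → DirectSum (a ∷ᶠ e) (g v) (g w)
    g-resp v w h zero    = -≈0⇒≈ (Kry-divisible d∣q (suc n) X y (pivot-divides P) h i)
    g-resp v w h (suc l) = resp _ _ (Kry-resp n (λ _ _ → ≈-refl) (λ _ → ≈-refl) (λ j → ≡⇒≈ (π-minus v w j)) (Kry-reduce P X n _ h)) l
    g-add : ∀ v w → DirectSum (a ∷ᶠ e) (g (v +v w)) (g v +v g w)
    g-add v w zero    = ≈-refl
    g-add v w (suc l) = ≈-trans (resp _ _ (≗⇒Coker (π-+ v w)) l) (add (π v) (π w) l)
    g-inj : ∀ v w → DirectSum (a ∷ᶠ e) (g v) (g w) → Coker X y v w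
    g-inj v w h = Kry-unreduce P X n _ (≈⇒-≈0 (h zero))
      (Kry-resp n (λ _ _ → ≈-refl) (λ _ → ≈-refl) (λ j → ≡⇒≈ (sym (π-minus v w j))) (inj _ _ (h ∘ suc)))
    g-surj : ∀ x → Σ (Vecℤ (suc n)) λ v → DirectSum (a ∷ᶠ e) (g v) x
    g-surj x = lift uᵢ≡1 (x zero) w , λ
      { zero    → ≡⇒≈ (lift-i uᵢ≡1 (x zero) w)
      ; (suc l) → ≈-trans (resp _ _ (≗⇒Coker (π-lift uᵢ≡1 (x zero) w)) l) (proj₂ (surj (x ∘ suc)) l)
      }
      where
      w = proj₁ (surj (x ∘ suc))

  next-vector-divisible : ∀ {n a} {y : Vecℤ (suc n)} (P : Pivot (p ^ a) y) X → Divisible a (next-vector P X)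
  next-vector-divisible {a = a} P X j =
    ≈-respˡ (ℤₚ.*-comm (Reduction.next (Pivot.i P) (Pivot.u P) X j) (+ (p ^ a))) (multiple-≈0 (p ^ a) (Reduction.next (Pivot.i P) (Pivot.u P) X j))

  -- The lower bound a strengthens the induction: after a pivot of valuation b the next starting
  -- vector is divisible by p ^ b, so all later exponents are at least b and the list is
  -- nondecreasing.
  cokernel-type : ∀ {n} (X : Matℤ n) y a → a ≤ m → Divisible a y →
    Σ (Fin n → ℕ) λ e → NonDecreasing e × (∀ i → a ≤ e i) × HasType e X y
  cokernel-type {zero}  X y a a≤m h = (λ ()) , tt , (λ ()) , (λ v → v) , (λ _ _ _ ()) , (λ _ _ ()) , (λ _ _ _ ()) , (λ x → x , λ ())
  cokernel-type {suc n} X y a a≤m h with pivot y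
  ... | b , V , P with cokernel-type (Reduction.block (Pivot.i P) (Pivot.u P) X) (next-vector P X) b (Valuation.a≤m V) (next-vector-divisible {a = b} P X)
  ...   | e , nd , b≤e , iso = b ∷ᶠ e , (b≤e , nd) , (λ { zero → a≤b ; (suc i) → ℕₚ.≤-trans a≤b (b≤e i) }) , HasType-∷ {e = e} P X iso
    where
    a≤b = Valuation-≤ V a≤m h

  HasType-unique : ∀ {n} {e e′ : Fin n → ℕ} {X y} → NonDecreasing e → NonDecreasing e′ →
    HasType e X y → HasType e′ X y → e ≗ e′
  HasType-unique {e = e} {e′} nd nd′ h h′ = DirectSum-unique nd nd′ (QuotIso-compose {e = e′} (QuotIso-inverse {e = e} h) h′)

  -- The reduction computes one nondecreasing type; by uniqueness, comparing it with e settles the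
  -- question.
  decideType : ∀ {n} (e : Fin n → ℕ) → NonDecreasing e → ∀ X y → Dec (HasType e X y)
  decideType {n} e nd X y with cokernel-type X y 0 ℕ.z≤n (λ j → ≈-mod-1 (y j) 0ℤ)
  ... | e′ , nd′ , _ , h′ with Finₚ.all? (λ i → e′ i ℕ.≟ e i)
  ...   | yes eq = yes (HasType-resp eq (λ _ _ → ≈-refl) (λ _ → ≈-refl) h′)
  ...   | no neq = no λ h → neq (HasType-unique {e = e′} {e} {X} {y} nd′ nd h′ h)

  abstract
    hasType? : ∀ {n} (e : Fin n → ℕ) → NonDecreasing e → ∀ X y → Dec (HasType e X y)
    hasType? = decideType

  -- Cancellation of the first summand goes through uniqueness: the reduced pair has some type e′,
  -- so the whole has type a ∷ e′, and this list must be e.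
  HasType-tail : ∀ {n a} {e : Fin (suc n) → ℕ} {y : Vecℤ (suc n)} (V : Valuation y a) (P : Pivot (p ^ a) y) (X : Matℤ (suc n)) →
    NonDecreasing e → HasType e X y →
    e zero ≡ a × HasType (e ∘ suc) (Reduction.block (Pivot.i P) (Pivot.u P) X) (next-vector P X)
  HasType-tail {n} {a} {e} {y} V P X nd h
    with cokernel-type (Reduction.block (Pivot.i P) (Pivot.u P) X) (next-vector P X) a (Valuation.a≤m V) (next-vector-divisible {a = a} P X)
  ... | e′ , nd′ , a≤e′ , iso = eq zero , HasType-resp (λ i → sym (eq (suc i))) (λ _ _ → ≈-refl) (λ _ → ≈-refl) iso
    where
    eq : e ≗ a ∷ᶠ e′
    eq = HasType-unique {e = e} {a ∷ᶠ e′} {X} {y} nd (a≤e′ , nd′) h (HasType-∷ {e = e′} P X iso)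

-- Sums over residues, vectors and matrices

indicator : ∀ {P : Set} → Dec P → ℕ
indicator (yes _) = 1
indicator (no _)  = 0

indicator-cong : ∀ {P Q : Set} (P? : Dec P) (Q? : Dec Q) → (P → Q) → (Q → P) → indicator P? ≡ indicator Q?
indicator-cong (yes _) (yes _) _ _ = refl
indicator-cong (no _)  (no _)  _ _ = refl
indicator-cong (yes a) (no ¬b) f _ = contradiction (f a) ¬b
indicator-cong (no ¬a) (yes b) _ g = contradiction (g b) ¬a

indicator-yes : ∀ {P : Set} (P? : Dec P) → P → indicator P? ≡ 1
indicator-yes (yes _) _ = refl
indicator-yes (no ¬a) a = contradiction a ¬a

indicator-no : ∀ {P : Set} (P? : Dec P) → ¬ P → indicator P? ≡ 0
indicator-no (yes a) ¬a = contradiction a ¬a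
indicator-no (no _)  _  = refl

module _ {A : Set} where

  sumOver : List A → (A → ℕ) → ℕ
  sumOver []       F = 0
  sumOver (x ∷ xs) F = F x ℕ.+ sumOver xs F

  sumOver-cong : ∀ xs {F G : A → ℕ} → F ≗ G → sumOver xs F ≡ sumOver xs G
  sumOver-cong []       h = refl
  sumOver-cong (x ∷ xs) h = cong₂ ℕ._+_ (h x) (sumOver-cong xs h)

  sumOver-zero : ∀ xs → sumOver xs (λ _ → 0) ≡ 0
  sumOver-zero []       = refl
  sumOver-zero (x ∷ xs) = sumOver-zero xs

  sumOver-+ : ∀ xs (F G : A → ℕ) → sumOver xs (λ x → F x ℕ.+ G x) ≡ sumOver xs F ℕ.+ sumOver xs G
  sumOver-+ []       F G = refl
  sumOver-+ (x ∷ xs) F G = trans (cong (F x ℕ.+ G x ℕ.+_) (sumOver-+ xs F G)) (eq (F x) (G x) _ _)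
    where
    eq : ∀ a b c d → a ℕ.+ b ℕ.+ (c ℕ.+ d) ≡ a ℕ.+ c ℕ.+ (b ℕ.+ d)
    eq = solveℕ-∀

  sumOver-*ʳ : ∀ xs (F : A → ℕ) c → sumOver xs (λ x → F x ℕ.* c) ≡ sumOver xs F ℕ.* c
  sumOver-*ʳ []       F c = refl
  sumOver-*ʳ (x ∷ xs) F c = trans (cong (F x ℕ.* c ℕ.+_) (sumOver-*ʳ xs F c)) (sym (ℕₚ.*-distribʳ-+ c (F x) _))

  sumOver-++ : ∀ xs ys (F : A → ℕ) → sumOver (xs ++ ys) F ≡ sumOver xs F ℕ.+ sumOver ys F
  sumOver-++ []       ys F = refl
  sumOver-++ (x ∷ xs) ys F = trans (cong (F x ℕ.+_) (sumOver-++ xs ys F)) (sym (ℕₚ.+-assoc (F x) _ _))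

  length-filter : ∀ {P : A → Set} (P? : Decidable P) xs → length (filter P? xs) ≡ sumOver xs (λ x → indicator (P? x))
  length-filter P? []       = refl
  length-filter P? (x ∷ xs) with P? x
  ... | yes _ = cong suc (length-filter P? xs)
  ... | no _  = length-filter P? xs

sumOver-swap : ∀ {A B : Set} (xs : List A) (ys : List B) (F : A → B → ℕ) →
  sumOver xs (λ x → sumOver ys (F x)) ≡ sumOver ys (λ y → sumOver xs (λ x → F x y))
sumOver-swap []       ys F = sym (sumOver-zero ys)
sumOver-swap (x ∷ xs) ys F = trans (cong (sumOver ys (F x) ℕ.+_) (sumOver-swap xs ys F)) (sym (sumOver-+ ys (F x) _))

sumOver-map : ∀ {A B : Set} (f : A → B) xs F → sumOver (map f xs) F ≡ sumOver xs (F ∘ f)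
sumOver-map f []       F = refl
sumOver-map f (x ∷ xs) F = cong (F (f x) ℕ.+_) (sumOver-map f xs F)

sumOver-concatMap : ∀ {A B : Set} (f : A → List B) xs F → sumOver (concatMap f xs) F ≡ sumOver xs (λ x → sumOver (f x) F)
sumOver-concatMap f []       F = refl
sumOver-concatMap f (x ∷ xs) F = trans (sumOver-++ (f x) (concatMap f xs) F) (cong (sumOver (f x) F ℕ.+_) (sumOver-concatMap f xs F))

sumOver-allFuns : ∀ {A : Set} (xs : List A) k F →
  sumOver (allFuns xs (suc k)) F ≡ sumOver xs (λ a → sumOver (allFuns xs k) (λ f → F (a ∷ᶠ f)))
sumOver-allFuns xs k F = trans (sumOver-concatMap _ xs F) (sumOver-cong xs (λ a → sumOver-map (a ∷ᶠ_) (allFuns xs k) F))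

∷ᶠ-cong : ∀ {A : Set} {k} (a : A) {f g : Fin k → A} → f ≗ g → a ∷ᶠ f ≗ a ∷ᶠ g
∷ᶠ-cong a h zero    = refl
∷ᶠ-cong a h (suc i) = h i

-- The coordinate i is summed first. F has to respect pointwise equality because inserting an entry
-- yields the enumerated functions only pointwise.
sumOver-insertAt : ∀ {A : Set} (xs : List A) {k} (i : Fin (suc k)) (F : (Fin (suc k) → A) → ℕ) → (∀ {f g} → f ≗ g → F f ≡ F g) →
  sumOver (allFuns xs (suc k)) F ≡ sumOver xs (λ a → sumOver (allFuns xs k) (λ f → F (insertAt f i a)))
sumOver-insertAt xs {k} zero F F-resp = trans (sumOver-allFuns xs k F)
  (sumOver-cong xs λ a → sumOver-cong (allFuns xs k) λ f → F-resp λ { zero → refl ; (suc j) → refl })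
sumOver-insertAt xs {suc k} (suc i) F F-resp = begin
  sumOver (allFuns xs (suc (suc k))) F
    ≡⟨ sumOver-allFuns xs (suc k) F ⟩
  sumOver xs (λ b → sumOver (allFuns xs (suc k)) (λ f → F (b ∷ᶠ f)))
    ≡⟨ sumOver-cong xs (λ b → sumOver-insertAt xs i (λ f → F (b ∷ᶠ f)) (λ h → F-resp (∷ᶠ-cong b h))) ⟩
  sumOver xs (λ b → sumOver xs (λ a → sumOver (allFuns xs k) (λ g → F (b ∷ᶠ insertAt g i a))))
    ≡⟨ sumOver-swap xs xs _ ⟩
  sumOver xs (λ a → sumOver xs (λ b → sumOver (allFuns xs k) (λ g → F (b ∷ᶠ insertAt g i a))))
    ≡⟨ sumOver-cong xs (λ a → sumOver-cong xs λ b → sumOver-cong (allFuns xs k) λ g → F-resp λ { zero → refl ; (suc j) → refl }) ⟩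
  sumOver xs (λ a → sumOver xs (λ b → sumOver (allFuns xs k) (λ g → F (insertAt (b ∷ᶠ g) (suc i) a))))
    ≡⟨ sumOver-cong xs (λ a → sumOver-allFuns xs k (λ f → F (insertAt f (suc i) a))) ⟨
  sumOver xs (λ a → sumOver (allFuns xs (suc k)) (λ f → F (insertAt f (suc i) a))) ∎
  where open ≡-Reasoning

sumBelow : ℕ → (ℕ → ℕ) → ℕ
sumBelow zero    G = 0
sumBelow (suc N) G = G 0 ℕ.+ sumBelow N (G ∘ suc)

sumBelow-cong : ∀ N {G H : ℕ → ℕ} → G ≗ H → sumBelow N G ≡ sumBelow N H
sumBelow-cong zero    h = refl
sumBelow-cong (suc N) h = cong₂ ℕ._+_ (h 0) (sumBelow-cong N (h ∘ suc))

sumBelow-zero : ∀ N (G : ℕ → ℕ) → (∀ x → x < N → G x ≡ 0) → sumBelow N G ≡ 0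
sumBelow-zero zero    G h = refl
sumBelow-zero (suc N) G h = cong₂ ℕ._+_ (h 0 ℕ.z<s) (sumBelow-zero N (G ∘ suc) (λ x x<N → h (suc x) (ℕ.s<s x<N)))

sumBelow-+ : ∀ a b (G : ℕ → ℕ) → sumBelow (a ℕ.+ b) G ≡ sumBelow a G ℕ.+ sumBelow b (λ x → G (a ℕ.+ x))
sumBelow-+ zero    b G = refl
sumBelow-+ (suc a) b G = trans (cong (G 0 ℕ.+_) (sumBelow-+ a b (G ∘ suc))) (sym (ℕₚ.+-assoc (G 0) _ _))

sumBelow-last : ∀ N (G : ℕ → ℕ) → sumBelow (suc N) G ≡ sumBelow N G ℕ.+ G N
sumBelow-last zero    G = ℕₚ.+-comm (G 0) 0
sumBelow-last (suc N) G = trans (cong (G 0 ℕ.+_) (sumBelow-last N (G ∘ suc))) (sym (ℕₚ.+-assoc (G 0) _ _))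

sumBelow-periodic : ∀ k s (G : ℕ → ℕ) → (∀ x → G (s ℕ.+ x) ≡ G x) → sumBelow (k ℕ.* s) G ≡ k ℕ.* sumBelow s G
sumBelow-periodic zero    s G h = refl
sumBelow-periodic (suc k) s G h = trans (sumBelow-+ s (k ℕ.* s) G)
  (cong (sumBelow s G ℕ.+_) (trans (sumBelow-cong (k ℕ.* s) h) (sumBelow-periodic k s G h)))

sumOver-allFinL : ∀ N (G : ℕ → ℕ) → sumOver (allFinL N) (G ∘ toℕ) ≡ sumBelow N G
sumOver-allFinL zero    G = refl
sumOver-allFinL (suc N) G = cong (G 0 ℕ.+_) (trans (sumOver-map suc (allFinL N) (G ∘ toℕ)) (sumOver-allFinL N (G ∘ suc)))

-- Uniform residues and the linear change of variables

module Residues (q : ℕ) .{{_ : NonZero q}} where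

  residues : List ℤ
  residues = map (λ i → + toℕ i) (allFinL q)

  vectors : ∀ n → List (Vecℤ n)
  vectors = allFuns residues

  matrices : ∀ r n → List (Fin r → Vecℤ n)
  matrices r n = allFuns (vectors n) r

  Periodic : (ℤ → ℕ) → Set
  Periodic F = ∀ {x y} → x ≈ y [mod q ] → F x ≡ F y

  Periodicᵛ : ∀ {n} → (Vecℤ n → ℕ) → Set
  Periodicᵛ F = ∀ {v w} → v ≋ w [mod q ] → F v ≡ F w

  sumOver-residues : ∀ F → sumOver residues F ≡ sumBelow q (λ x → F (+ x))
  sumOver-residues F = trans (sumOver-map _ (allFinL q) F) (sumOver-allFinL q (λ x → F (+ x)))

  sumOver-residues-shift : ∀ F → Periodic F → ∀ c → sumOver residues (λ x → F (x + c)) ≡ sumOver residues F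
  sumOver-residues-shift F F-per c = begin
    sumOver residues (λ x → F (x + c))             ≡⟨ sumOver-cong residues (λ x → F-per (+-cong-≈ (≈-refl {x = x}) (≈-residue c q))) ⟩
    sumOver residues (λ x → F (x + + (c %ℕ q)))    ≡⟨ shift-by (c %ℕ q) F F-per ⟩
    sumOver residues F                             ∎
    where
    open ≡-Reasoning
    q≈0 : + q ≈ 0ℤ [mod q ]
    q≈0 = ≈-respˡ (ℤₚ.*-identityˡ (+ q)) (multiple-≈0 q 1ℤ)
    -- Adding F 0, which equals F q, completes both sides to the sum over 0, ..., q.
    shift-one : ∀ F → Periodic F → sumOver residues (λ x → F (x + 1ℤ)) ≡ sumOver residues F
    shift-one F F-per = ℕₚ.+-cancelˡ-≡ (F 0ℤ) _ _ (begin
      F 0ℤ ℕ.+ sumOver residues (λ x → F (x + 1ℤ))        ≡⟨ cong (F 0ℤ ℕ.+_) (sumOver-residues (λ x → F (x + 1ℤ))) ⟩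
      F 0ℤ ℕ.+ sumBelow q (λ x → F (+ x + 1ℤ))            ≡⟨ cong (F 0ℤ ℕ.+_) (sumBelow-cong q (λ x → cong F (ℤₚ.+-comm (+ x) 1ℤ))) ⟩
      sumBelow (suc q) (λ x → F (+ x))                    ≡⟨ sumBelow-last q (λ x → F (+ x)) ⟩
      sumBelow q (λ x → F (+ x)) ℕ.+ F (+ q)              ≡⟨ cong₂ ℕ._+_ (sumOver-residues F) (F-per (≈-sym q≈0)) ⟨
      sumOver residues F ℕ.+ F 0ℤ                         ≡⟨ ℕₚ.+-comm _ (F 0ℤ) ⟩
      F 0ℤ ℕ.+ sumOver residues F                         ∎)
    shift-by : ∀ k F → Periodic F → sumOver residues (λ x → F (x + + k)) ≡ sumOver residues F
    shift-by zero    F F-per = sumOver-cong residues (λ x → cong F (ℤₚ.+-identityʳ x))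
    shift-by (suc k) F F-per = begin
      sumOver residues (λ x → F (x + + suc k))     ≡⟨ sumOver-cong residues (λ x → cong F (eq x (+ k))) ⟩
      sumOver residues (λ x → F (x + + k + 1ℤ))    ≡⟨ shift-by k (λ x → F (x + 1ℤ)) (λ h → F-per (+-cong-≈ h ≈-refl)) ⟩
      sumOver residues (λ x → F (x + 1ℤ))          ≡⟨ shift-one F F-per ⟩
      sumOver residues F                           ∎
      where
      eq : ∀ x k → x + (1ℤ + k) ≡ x + k + 1ℤ
      eq = solve-∀

  ∷ᶠ-cong-≈ : ∀ {n x y} {v w : Vecℤ n} → x ≈ y [mod q ] → v ≋ w [mod q ] → (x ∷ᶠ v) ≋ (y ∷ᶠ w) [mod q ]
  ∷ᶠ-cong-≈ h k zero    = h
  ∷ᶠ-cong-≈ h k (suc i) = k i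

  sumOver-vectors-translate : ∀ {n} (F : Vecℤ n → ℕ) → Periodicᵛ F → ∀ (w : Vecℤ n) →
    sumOver (vectors n) (λ v → F (λ i → v i - w i)) ≡ sumOver (vectors n) F
  sumOver-vectors-translate {zero}  F F-per w = cong (ℕ._+ 0) (F-per (λ ()))
  sumOver-vectors-translate {suc n} F F-per w = begin
    sumOver (vectors (suc n)) (λ v → F (λ i → v i - w i))
      ≡⟨ sumOver-allFuns residues n _ ⟩
    sumOver residues (λ x → sumOver (vectors n) (λ v → F (λ i → (x ∷ᶠ v) i - w i)))
      ≡⟨ sumOver-cong residues (λ x → sumOver-cong (vectors n) λ v → F-per λ { zero → ≈-refl ; (suc i) → ≈-refl }) ⟩
    sumOver residues (λ x → sumOver (vectors n) (λ v → F ((x - w zero) ∷ᶠ (λ i → v i - w (suc i)))))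
      ≡⟨ sumOver-cong residues (λ x → sumOver-vectors-translate (λ v → F ((x - w zero) ∷ᶠ v)) (λ h → F-per (∷ᶠ-cong-≈ ≈-refl h)) (w ∘ suc)) ⟩
    sumOver residues (λ x → sumOver (vectors n) (λ v → F ((x - w zero) ∷ᶠ v)))
      ≡⟨ sumOver-residues-shift (λ x → sumOver (vectors n) (λ v → F (x ∷ᶠ v)))
           (λ h → sumOver-cong (vectors n) (λ v → F-per (∷ᶠ-cong-≈ h (λ _ → ≈-refl)))) (- w zero) ⟩
    sumOver residues (λ x → sumOver (vectors n) (λ v → F (x ∷ᶠ v)))
      ≡⟨ sumOver-allFuns residues n F ⟨
    sumOver (vectors (suc n)) F ∎
    where open ≡-Reasoning

  sumOver-vectors-const : ∀ n c → sumOver (vectors n) (λ _ → c) ≡ q ^ n ℕ.* c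
  sumOver-vectors-const zero    c = refl
  sumOver-vectors-const (suc n) c = begin
    sumOver (vectors (suc n)) (λ _ → c)                       ≡⟨ sumOver-allFuns residues n _ ⟩
    sumOver residues (λ _ → sumOver (vectors n) (λ _ → c))    ≡⟨ sumOver-cong residues (λ _ → sumOver-vectors-const n c) ⟩
    sumOver residues (λ _ → q ^ n ℕ.* c)                      ≡⟨ sumOver-residues _ ⟩
    sumBelow q (λ _ → q ^ n ℕ.* c)                            ≡⟨ const q ⟩
    q ℕ.* (q ^ n ℕ.* c)                                       ≡⟨ ℕₚ.*-assoc q (q ^ n) c ⟨
    q ^ suc n ℕ.* c                                           ∎
    where
    open ≡-Reasoning
    const : ∀ N {x} → sumBelow N (λ _ → x) ≡ N ℕ.* x
    const zero    = refl
    const (suc N) = cong (_ ℕ.+_) (const N)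

  module _ {n} (i : Fin (suc n)) (u : Vecℤ (suc n)) (uᵢ≡1 : u i ≡ 1ℤ) where

    -- The coordinate i of a row enters (σ − w) ∙ u with coefficient 1, so for fixed other
    -- coordinates that scalar product is uniformly distributed.
    sumOver-row : ∀ (H : ℤ → Vecℤ n → ℕ) → (∀ {x y v w} → x ≈ y [mod q ] → v ≋ w [mod q ] → H x v ≡ H y w) →
      ∀ (w : Vecℤ (suc n)) →
      sumOver (vectors (suc n)) (λ σ → H ((λ k → σ k - w k) ∙ u) (λ k → σ (punchIn i k) - w (punchIn i k)))
        ≡ sumOver residues (λ s → sumOver (vectors n) (H s))
    sumOver-row H H-per w = begin
      sumOver (vectors (suc n)) (λ σ → H ((λ k → σ k - w k) ∙ u) (λ k → σ (punchIn i k) - w′ k))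
        ≡⟨ sumOver-insertAt residues i _ (λ h → H-per (∙-cong-≈ {v = u} (λ k → ≡⇒≈ (cong (_- w k) (h k))) (λ _ → ≈-refl)) (λ k → ≡⇒≈ (cong (_- w′ k) (h (punchIn i k))))) ⟩
      sumOver residues (λ s → sumOver (vectors n) (λ τ → H ((λ k → insertAt τ i s k - w k) ∙ u) (λ k → insertAt τ i s (punchIn i k) - w′ k)))
        ≡⟨ sumOver-cong residues (λ s → sumOver-cong (vectors n) λ τ → H-per (≡⇒≈ (split s τ)) (λ k → ≡⇒≈ (cong (_- w′ k) (insertAt-punchIn τ i s k)))) ⟩
      sumOver residues (λ s → sumOver (vectors n) (λ τ → H (s + offset τ) (λ k → τ k - w′ k)))
        ≡⟨ sumOver-swap residues (vectors n) _ ⟩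
      sumOver (vectors n) (λ τ → sumOver residues (λ s → H (s + offset τ) (λ k → τ k - w′ k)))
        ≡⟨ sumOver-cong (vectors n) (λ τ → sumOver-residues-shift (λ s → H s (λ k → τ k - w′ k)) (λ h → H-per h (λ _ → ≈-refl)) (offset τ)) ⟩
      sumOver (vectors n) (λ τ → sumOver residues (λ s → H s (λ k → τ k - w′ k)))
        ≡⟨ sumOver-vectors-translate (λ τ → sumOver residues (λ s → H s τ)) (λ h → sumOver-cong residues (λ s → H-per ≈-refl h)) w′ ⟩
      sumOver (vectors n) (λ τ → sumOver residues (λ s → H s τ))
        ≡⟨ sumOver-swap residues (vectors n) H ⟨
      sumOver residues (λ s → sumOver (vectors n) (H s)) ∎
      where
      open ≡-Reasoning
      w′ = w ∘ punchIn i
      offset : Vecℤ n → ℤ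
      offset τ = - w i + (λ k → τ k - w′ k) ∙ (u ∘ punchIn i)
      eq : ∀ s a b → (s - a) * 1ℤ + b ≡ s + (- a + b)
      eq = solve-∀
      split : ∀ s τ → (λ k → insertAt τ i s k - w k) ∙ u ≡ s + offset τ
      split s τ = begin
        (λ k → insertAt τ i s k - w k) ∙ u
          ≡⟨ Σℤ-remove i (λ k → (insertAt τ i s k - w k) * u k) ⟩
        (insertAt τ i s i - w i) * u i + (λ k → insertAt τ i s (punchIn i k) - w′ k) ∙ (u ∘ punchIn i)
          ≡⟨ cong₂ _+_ (cong₂ (λ a b → (a - w i) * b) (insertAt-lookup τ i s) uᵢ≡1)
               (Σℤ-cong (λ k → cong (λ a → (a - w′ k) * u (punchIn i k)) (insertAt-punchIn τ i s k))) ⟩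
        (s - w i) * 1ℤ + (λ k → τ k - w′ k) ∙ (u ∘ punchIn i)
          ≡⟨ eq s (w i) _ ⟩
        s + offset τ ∎

    -- Rows are independent, so `sumOver-row` is applied to one row at a time, the sums over the
    -- other rows being part of its H.
    sumOver-rows : ∀ r (F : Vecℤ r → (Fin r → Vecℤ n) → ℕ) →
      (∀ {y y′ B B′} → y ≋ y′ [mod q ] → (∀ j → B j ≋ B′ j [mod q ]) → F y B ≡ F y′ B′) →
      ∀ (w : Fin r → Vecℤ (suc n)) →
      sumOver (matrices r (suc n)) (λ M → F (λ j → (λ k → M j k - w j k) ∙ u) (λ j k → M j (punchIn i k) - w j (punchIn i k)))
        ≡ sumOver (vectors r) (λ y → sumOver (matrices r n) (F y))
    sumOver-rows zero F F-per w = cong (ℕ._+ 0) (trans (F-per (λ ()) (λ ())) (sym (ℕₚ.+-identityʳ _)))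
    sumOver-rows (suc r) F F-per w = begin
      sumOver (matrices (suc r) (suc n)) (λ M → F (λ j → (λ k → M j k - w j k) ∙ u) (λ j k → M j (punchIn i k) - w j (punchIn i k)))
        ≡⟨ sumOver-allFuns (vectors (suc n)) r _ ⟩
      sumOver (vectors (suc n)) (λ σ → sumOver (matrices r (suc n)) (λ M →
        F (λ j → (λ k → (σ ∷ᶠ M) j k - w j k) ∙ u) (λ j k → (σ ∷ᶠ M) j (punchIn i k) - w j (punchIn i k))))
        ≡⟨ sumOver-cong (vectors (suc n)) (λ σ → sumOver-cong (matrices r (suc n)) λ M →
             F-per (λ { zero → ≈-refl ; (suc j) → ≈-refl }) (λ { zero k → ≈-refl ; (suc j) k → ≈-refl })) ⟩
      sumOver (vectors (suc n)) (λ σ → sumOver (matrices r (suc n)) (λ M →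
        F (s σ ∷ᶠ (λ j → (λ k → M j k - w (suc j) k) ∙ u)) (t σ ∷ᶠ (λ j k → M j (punchIn i k) - w (suc j) (punchIn i k)))))
        ≡⟨ sumOver-cong (vectors (suc n)) (λ σ → sumOver-rows r (λ y B → F (s σ ∷ᶠ y) (t σ ∷ᶠ B))
             (λ hy hB → F-per (∷ᶠ-cong-≈ ≈-refl hy) (λ { zero k → ≈-refl ; (suc j) → hB j })) (w ∘ suc)) ⟩
      sumOver (vectors (suc n)) (λ σ → sumOver (vectors r) (λ y → sumOver (matrices r n) (λ B → F (s σ ∷ᶠ y) (t σ ∷ᶠ B))))
        ≡⟨ sumOver-row (λ x v → sumOver (vectors r) (λ y → sumOver (matrices r n) (λ B → F (x ∷ᶠ y) (v ∷ᶠ B))))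
             (λ hx hv → sumOver-cong (vectors r) λ y → sumOver-cong (matrices r n) λ B →
               F-per (∷ᶠ-cong-≈ hx (λ _ → ≈-refl)) (λ { zero → hv ; (suc j) k → ≈-refl })) (w zero) ⟩
      sumOver residues (λ x → sumOver (vectors n) (λ v → sumOver (vectors r) (λ y → sumOver (matrices r n) (λ B → F (x ∷ᶠ y) (v ∷ᶠ B)))))
        ≡⟨ sumOver-cong residues (λ x → sumOver-swap (vectors n) (vectors r) _) ⟩
      sumOver residues (λ x → sumOver (vectors r) (λ y → sumOver (vectors n) (λ v → sumOver (matrices r n) (λ B → F (x ∷ᶠ y) (v ∷ᶠ B)))))
        ≡⟨ sumOver-cong residues (λ x → sumOver-cong (vectors r) λ y → sumOver-allFuns (vectors n) r (F (x ∷ᶠ y))) ⟨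
      sumOver residues (λ x → sumOver (vectors r) (λ y → sumOver (matrices (suc r) n) (F (x ∷ᶠ y))))
        ≡⟨ sumOver-allFuns residues r _ ⟨
      sumOver (vectors (suc r)) (λ y → sumOver (matrices (suc r) n) (F y)) ∎
      where
      open ≡-Reasoning
      s : Vecℤ (suc n) → ℤ
      s σ = (λ k → σ k - w zero k) ∙ u
      t : Vecℤ (suc n) → Vecℤ n
      t σ k = σ (punchIn i k) - w zero (punchIn i k)

    open Reduction i u

    -- Fix row i of X, say ρ. The rows of the projected matrix are then the remaining rows of X
    -- translated by multiples of ρ, and `sumOver-rows` absorbs the translation. The result is the
    -- same for all q ^ (n + 1) choices of ρ, whence the factor.
    sumOver-reduction : ∀ (F : Vecℤ n → Matℤ n → ℕ) →
      (∀ {y y′ B B′} → y ≋ y′ [mod q ] → (∀ j → B j ≋ B′ j [mod q ]) → F y B ≡ F y′ B′) →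
      sumOver (matrices (suc n) (suc n)) (λ X → F (next X) (block X))
        ≡ q ^ suc n ℕ.* sumOver (vectors n) (λ y → sumOver (matrices n n) (F y))
    sumOver-reduction F F-per = begin
      sumOver (matrices (suc n) (suc n)) (λ X → F (next X) (block X))
        ≡⟨ sumOver-insertAt (vectors (suc n)) i _ (λ {f} {g} h → F-per (λ j → ∙-cong-≈ {v = u} (rows-cong f g (λ r k → cong (λ row → row k) (h r)) j) (λ _ → ≈-refl))
             (λ j k → rows-cong f g (λ r k → cong (λ row → row k) (h r)) j (punchIn i k))) ⟩
      sumOver (vectors (suc n)) (λ ρ → sumOver (matrices n (suc n)) (λ M → F (next (insertAt M i ρ)) (block (insertAt M i ρ))))
        ≡⟨ sumOver-cong (vectors (suc n)) (λ ρ → sumOver-cong (matrices n (suc n)) λ M →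
             F-per (λ j → ∙-cong-≈ {v = u} (rows-insertAt ρ M j) (λ _ → ≈-refl)) (λ j k → rows-insertAt ρ M j (punchIn i k))) ⟩
      sumOver (vectors (suc n)) (λ ρ → sumOver (matrices n (suc n)) (λ M →
        F (λ j → (λ k → M j k - u (punchIn i j) * ρ k) ∙ u) (λ j k → M j (punchIn i k) - u (punchIn i j) * ρ (punchIn i k))))
        ≡⟨ sumOver-cong (vectors (suc n)) (λ ρ → sumOver-rows n F F-per (λ j k → u (punchIn i j) * ρ k)) ⟩
      sumOver (vectors (suc n)) (λ _ → sumOver (vectors n) (λ y → sumOver (matrices n n) (F y)))
        ≡⟨ sumOver-vectors-const (suc n) _ ⟩
      q ^ suc n ℕ.* sumOver (vectors n) (λ y → sumOver (matrices n n) (F y)) ∎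
      where
      open ≡-Reasoning
      rows-cong : ∀ X X′ → (∀ r k → X r k ≡ X′ r k) → ∀ j → rows X j ≋ rows X′ j [mod q ]
      rows-cong X X′ h j k = ≡⇒≈ (cong₂ (λ a b → a - u (punchIn i j) * b) (h (punchIn i j) k) (h i k))
      rows-insertAt : ∀ ρ M j → rows (insertAt M i ρ) j ≋ (λ k → M j k - u (punchIn i j) * ρ k) [mod q ]
      rows-insertAt ρ M j k = ≡⇒≈ (cong₂ (λ a b → a k - u (punchIn i j) * b k) (insertAt-punchIn M i ρ j) (insertAt-lookup M i ρ))

-- Used twice to pass from matrices over `Fin` to integer matrices: for the entries of a row, then
-- for the rows. The relation `_~_` is congruence, entrywise at the outer level.
sumOver-allFuns-map : ∀ {A B : Set} (_~_ : B → B → Set) → (∀ b → b ~ b) → (xs : List A) (ys : List B) (g : A → B) →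
  (∀ (F : B → ℕ) → (∀ {b b′} → b ~ b′ → F b ≡ F b′) → sumOver xs (F ∘ g) ≡ sumOver ys F) →
  ∀ k (F : (Fin k → B) → ℕ) → (∀ {f f′} → (∀ i → f i ~ f′ i) → F f ≡ F f′) →
  sumOver (allFuns xs k) (λ f → F (g ∘ f)) ≡ sumOver (allFuns ys k) F
sumOver-allFuns-map _~_ ~-refl xs ys g h zero    F F-resp = cong (ℕ._+ 0) (F-resp (λ ()))
sumOver-allFuns-map _~_ ~-refl xs ys g h (suc k) F F-resp = begin
  sumOver (allFuns xs (suc k)) (λ f → F (g ∘ f))
    ≡⟨ sumOver-allFuns xs k _ ⟩
  sumOver xs (λ a → sumOver (allFuns xs k) (λ f → F (g ∘ (a ∷ᶠ f))))
    ≡⟨ sumOver-cong xs (λ a → sumOver-cong (allFuns xs k) λ f → F-resp λ { zero → ~-refl _ ; (suc i) → ~-refl _ }) ⟩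
  sumOver xs (λ a → sumOver (allFuns xs k) (λ f → F (g a ∷ᶠ (g ∘ f))))
    ≡⟨ sumOver-cong xs (λ a → sumOver-allFuns-map _~_ ~-refl xs ys g h k (λ f → F (g a ∷ᶠ f))
         (λ eq → F-resp λ { zero → ~-refl _ ; (suc i) → eq i })) ⟩
  sumOver xs (λ a → sumOver (allFuns ys k) (λ f → F (g a ∷ᶠ f)))
    ≡⟨ h (λ b → sumOver (allFuns ys k) (λ f → F (b ∷ᶠ f)))
         (λ eq → sumOver-cong (allFuns ys k) λ f → F-resp λ { zero → eq ; (suc i) → ~-refl _ }) ⟩
  sumOver ys (λ b → sumOver (allFuns ys k) (λ f → F (b ∷ᶠ f)))
    ≡⟨ sumOver-allFuns ys k F ⟨
  sumOver (allFuns ys (suc k)) F ∎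
  where open ≡-Reasoning

-- Counting matrices with a given cokernel

·v-combination : ∀ {n k} (X : Matℤ n) (g : Fin k → Vecℤ n) (c : Vecℤ k) i →
  (X ·v (λ l → Σℤ k (λ j → g j l * c j))) i ≡ Σℤ k (λ j → (X ·v g j) i * c j)
·v-combination {n} {k} X g c i = begin
  Σℤ n (λ l → X i l * Σℤ k (λ j → g j l * c j))          ≡⟨ Σℤ-cong (λ l → Σℤ-* (X i l) (λ j → g j l * c j)) ⟨
  Σℤ n (λ l → Σℤ k (λ j → X i l * (g j l * c j)))        ≡⟨ Σℤ-swap (λ l j → X i l * (g j l * c j)) ⟩
  Σℤ k (λ j → Σℤ n (λ l → X i l * (g j l * c j)))        ≡⟨ Σℤ-cong (λ j → Σℤ-cong (λ l → eq (X i l) (g j l) (c j))) ⟩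
  Σℤ k (λ j → Σℤ n (λ l → c j * (X i l * g j l)))        ≡⟨ Σℤ-cong (λ j → trans (Σℤ-* (c j) (λ l → X i l * g j l)) (ℤₚ.*-comm (c j) _)) ⟩
  Σℤ k (λ j → (X ·v g j) i * c j)                        ∎
  where
  open ≡-Reasoning
  eq : ∀ x g c → x * (g * c) ≡ c * (x * g)
  eq = solve-∀

module CokernelCounts (p : ℕ) (prime : Prime p) (m : ℕ) where

  open CokernelTypes p prime m public

  instance
    q≢0 : NonZero (p ^ m)
    q≢0 = ℕₚ.m^n≢0 p m

  open Residues (p ^ m) public

  -- For k = n this is `walk X b ·v c`. A separate k allows induction on the number of columns
  -- against the Horner form of `Kry`.
  powerCombination : ∀ {n} k → Matℤ n → Vecℤ n → Vecℤ k → Vecℤ n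
  powerCombination k X b c i = Σℤ k (λ j → powApply X (toℕ j) b i * c j)

  powerCombination-suc : ∀ {n} k (X : Matℤ n) b c i →
    powerCombination (suc k) X b c i ≡ c zero * b i + (X ·v powerCombination k X b (c ∘ suc)) i
  powerCombination-suc k X b c i = cong₂ _+_ (ℤₚ.*-comm (b i) (c zero)) (sym (·v-combination X (λ j → powApply X (toℕ j) b) (c ∘ suc) i))

  Kry⇒combination : ∀ {n} k (X : Matℤ n) b v → Kry k X b v → Σ (Vecℤ k) λ c → v ≋ powerCombination k X b c [mod p ^ m ]
  Kry⇒combination zero    X b v h = (λ ()) , h
  Kry⇒combination (suc k) X b v (s , w , h , eq) with Kry⇒combination k X b w h
  ... | c , hw = s ∷ᶠ c , λ i → ≈-trans (eq i) (≈-trans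
    (+-cong-≈ (≈-refl {x = s * b i}) (∙-cong-≈ {r = X i} (λ _ → ≈-refl) hw))
    (≡⇒≈ (sym (powerCombination-suc k X b (s ∷ᶠ c) i))))

  combination⇒Kry : ∀ {n} k (X : Matℤ n) b v c → v ≋ powerCombination k X b c [mod p ^ m ] → Kry k X b v
  combination⇒Kry zero    X b v c h = h
  combination⇒Kry (suc k) X b v c h = c zero , powerCombination k X b (c ∘ suc) ,
    combination⇒Kry k X b _ (c ∘ suc) (λ _ → ≈-refl) , λ i → ≈-trans (h i) (≡⇒≈ (powerCombination-suc k X b c i))

  CokerRel⇒Coker : ∀ {n} (X : Matℤ n) b v w → CokerRel (walk X b) (p ^ m) v w → Coker X b v w
  CokerRel⇒Coker X b v w (c , t , h) = combination⇒Kry _ X b _ c λ i → ⟪ divides (t i) (trans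
    (cong (_- powerCombination _ X b c i) (h i)) (eq (powerCombination _ X b c i) (+ (p ^ m)) (t i))) ⟫
    where
    eq : ∀ a q t → a + q * t - a ≡ t * q
    eq = solve-∀

  Coker⇒CokerRel : ∀ {n} (X : Matℤ n) b v w → Coker X b v w → CokerRel (walk X b) (p ^ m) v w
  Coker⇒CokerRel X b v w h with Kry⇒combination _ X b _ h
  ... | c , hc = c , (λ i → _∣_.quotient (∣diff (hc i))) , λ i →
    trans (eq (v i - w i) (powerCombination _ X b c i))
      (cong₂ _+_ {x = powerCombination _ X b c i} refl (trans (_∣_.equality (∣diff (hc i))) (ℤₚ.*-comm _ (+ (p ^ m)))))
    where
    eq : ∀ a b → a ≡ b + (a - b)
    eq = solve-∀

  Valuation-unique : ∀ {n} {y : Vecℤ n} {a b} → Valuation y a → Valuation y b → a ≡ b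
  Valuation-unique V W = ℕₚ.≤-antisym (Valuation-≤ W (a≤m V) (divisible V)) (Valuation-≤ V (a≤m W) (divisible W))

  valuation? : ∀ {n} (y : Vecℤ (suc n)) a → Dec (Valuation y a)
  valuation? y a with pivot y
  ... | b , V , _ = map′ (λ b≡a → subst (Valuation y) b≡a V) (Valuation-unique V) (b ℕ.≟ a)

  pivotAt : ∀ {n} {y : Vecℤ (suc n)} {a} → Valuation y a → Pivot (p ^ a) y
  pivotAt {y = y} V with pivot y
  ... | b , W , P = subst (λ k → Pivot (p ^ k) y) (Valuation-unique W V) P

  scale : ∀ {n} → ℕ → Vecℤ n → Vecℤ n
  scale a y j = + (p ^ a) * y j

  count : ∀ {n} (e : Fin n → ℕ) → NonDecreasing e → Vecℤ n → ℕ
  count {n} e nd y = sumOver (matrices n n) (λ X → indicator (hasType? e nd X y))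

  -- Having type e is a condition on (`next X` , `block X`) alone once the first exponent matches,
  -- and this pair is uniform because the pivot is fixed before X is chosen.
  count-reduce : ∀ {n} (e : Fin (suc n) → ℕ) nd y → Valuation y (e zero) →
    count e nd y ≡ (p ^ m) ^ suc n ℕ.* sumOver (vectors n) (λ z → count (e ∘ suc) (proj₂ nd) (scale (e zero) z))
  count-reduce {n} e nd y V = trans (sumOver-cong (matrices (suc n) (suc n)) λ X →
      indicator-cong (hasType? e nd X y) (hasType? (e ∘ suc) (proj₂ nd) (block X) (scale (e zero) (next X)))
        (λ h → proj₂ (HasType-tail {e = e} V P X nd h))
        (λ h → HasType-resp {e = e zero ∷ᶠ (e ∘ suc)} {e} (λ { zero → refl ; (suc i) → refl }) (λ _ _ → ≈-refl) (λ _ → ≈-refl) (HasType-∷ {e = e ∘ suc} P X h)))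
    (sumOver-reduction i u uᵢ≡1 (λ z B → indicator (hasType? (e ∘ suc) (proj₂ nd) B (scale (e zero) z)))
      (λ {z} {z′} {B} {B′} hz hB → indicator-cong (hasType? (e ∘ suc) (proj₂ nd) B _) (hasType? (e ∘ suc) (proj₂ nd) B′ _)
        (HasType-resp {e = e ∘ suc} (λ _ → refl) hB (λ j → *-cong-≈ (≈-refl {x = + (p ^ e zero)}) (hz j)))
        (HasType-resp {e = e ∘ suc} (λ _ → refl) (λ j k → ≈-sym (hB j k)) (λ j → *-cong-≈ (≈-refl {x = + (p ^ e zero)}) (≈-sym (hz j))))))
    where
    P = pivotAt V
    open Pivot P
    open Reduction i u

  -- The first exponent of any nondecreasing type is the valuation of y, whatever X is.
  count-mismatch : ∀ {n} (e : Fin (suc n) → ℕ) nd y → ¬ Valuation y (e zero) → count e nd y ≡ 0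
  count-mismatch {n} e nd y ¬V = trans
    (sumOver-cong (matrices (suc n) (suc n)) λ X → indicator-no (hasType? e nd X y) λ h →
      ¬V (subst (Valuation y) (sym (proj₁ (HasType-tail {e = e} (proj₁ (proj₂ (pivot y))) (proj₂ (proj₂ (pivot y))) X nd h))) (proj₁ (proj₂ (pivot y)))))
    (sumOver-zero (matrices (suc n) (suc n)))

  -- The transition from exponent a to exponent b at remaining rank n + 1, not yet divided by the
  -- number of vectors z.
  valuationCount : ℕ → ℕ → ℕ → ℕ
  valuationCount n a b = sumOver (vectors (suc n)) (λ z → indicator (valuation? (scale a z) b))

  -- The unnormalised path weight of the chain. The power of p ^ m counts the row that the change of
  -- variables leaves free; at size one the matrix entry itself is free.
  typeCount : ∀ {n} → (Fin (suc n) → ℕ) → ℕ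
  typeCount {zero}  e = (p ^ m) ^ 1
  typeCount {suc n} e = (p ^ m) ^ (2 ℕ.+ n) ℕ.* (valuationCount n (e zero) (e (suc zero)) ℕ.* typeCount (e ∘ suc))

  -- The count sees y only through whether its valuation is `e zero`. Therefore the inner count is
  -- an indicator times a constant, and the sum over z factors.
  count≡typeCount : ∀ {n} (e : Fin (suc n) → ℕ) nd y (V? : Dec (Valuation y (e zero))) →
    count e nd y ≡ indicator V? ℕ.* typeCount e
  count≡typeCount e nd y (no ¬V) = count-mismatch e nd y ¬V
  count≡typeCount {zero} e nd y (yes V) = begin
    count e nd y                               ≡⟨ count-reduce e nd y V ⟩
    (p ^ m) ^ 1 ℕ.* (x ℕ.+ 0 ℕ.+ 0)            ≡⟨ cong (λ x → (p ^ m) ^ 1 ℕ.* (x ℕ.+ 0 ℕ.+ 0)) (indicator-yes (hasType? (e ∘ suc) (proj₂ nd) _ _) trivial) ⟩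
    (p ^ m) ^ 1 ℕ.* 1                          ≡⟨ ℕₚ.*-comm ((p ^ m) ^ 1) 1 ⟩
    1 ℕ.* (p ^ m) ^ 1                          ∎
    where
    open ≡-Reasoning
    x = indicator (hasType? (e ∘ suc) (proj₂ nd) (λ ()) (scale (e zero) (λ ())))
    trivial : HasType (e ∘ suc) (λ ()) (scale (e zero) (λ ()))
    trivial = (λ v → v) , (λ _ _ _ ()) , (λ _ _ ()) , (λ _ _ _ ()) , (λ x → x , λ ())
  count≡typeCount {suc n} e nd y (yes V) = begin
    count e nd y
      ≡⟨ count-reduce e nd y V ⟩
    Q ℕ.* sumOver (vectors (suc n)) (λ z → count (e ∘ suc) (proj₂ nd) (scale (e zero) z))
      ≡⟨ cong (Q ℕ.*_) (sumOver-cong (vectors (suc n)) (λ z → count≡typeCount (e ∘ suc) (proj₂ nd) (scale (e zero) z) (valuation? _ _))) ⟩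
    Q ℕ.* sumOver (vectors (suc n)) (λ z → indicator (valuation? (scale (e zero) z) (e (suc zero))) ℕ.* typeCount (e ∘ suc))
      ≡⟨ cong (Q ℕ.*_) (sumOver-*ʳ (vectors (suc n)) (λ z → indicator (valuation? (scale (e zero) z) (e (suc zero)))) (typeCount (e ∘ suc))) ⟩
    Q ℕ.* (valuationCount n (e zero) (e (suc zero)) ℕ.* typeCount (e ∘ suc))
      ≡⟨ ℕₚ.*-identityˡ (typeCount e) ⟨
    1 ℕ.* typeCount e ∎
    where
    open ≡-Reasoning
    Q = (p ^ m) ^ (2 ℕ.+ n)

  -- The indicator has period p ^ d, with a single hit per period, and p ^ m is p ^ (m ∸ d) periods.
  residues-divisible : ∀ d → d ≤ m → sumOver residues (λ x → indicator (x ≈? 0ℤ [mod p ^ d ])) ≡ p ^ (m ∸ d)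
  residues-divisible d d≤m = begin
    sumOver residues G                        ≡⟨ sumOver-residues G ⟩
    sumBelow (p ^ m) (λ x → G (+ x))          ≡⟨ cong (λ N → sumBelow N (λ x → G (+ x))) q≡ ⟩
    sumBelow (p ^ (m ∸ d) ℕ.* s) (λ x → G (+ x)) ≡⟨ sumBelow-periodic (p ^ (m ∸ d)) s _ periodic ⟩
    p ^ (m ∸ d) ℕ.* sumBelow s (λ x → G (+ x))   ≡⟨ cong (p ^ (m ∸ d) ℕ.*_) (one s (ℕ.>-nonZero⁻¹ s {{ℕₚ.m^n≢0 p d}}) refl) ⟩
    p ^ (m ∸ d) ℕ.* 1                         ≡⟨ ℕₚ.*-identityʳ _ ⟩
    p ^ (m ∸ d)                               ∎
    where
    open ≡-Reasoning
    s = p ^ d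
    G : ℤ → ℕ
    G x = indicator (x ≈? 0ℤ [mod s ])
    q≡ : p ^ m ≡ p ^ (m ∸ d) ℕ.* s
    q≡ = trans (cong (p ^_) (sym (ℕₚ.m∸n+n≡m d≤m))) (ℕₚ.^-distribˡ-+-* p (m ∸ d) d)
    s+x≈x : ∀ x → + (s ℕ.+ x) ≈ + x [mod s ]
    s+x≈x x = ⟪ divides 1ℤ (trans (cong (_- + x) (ℤₚ.pos-+ s x)) (eq (+ s) (+ x))) ⟫
      where
      eq : ∀ a b → a + b - b ≡ 1ℤ * a
      eq = solve-∀
    periodic : ∀ x → G (+ (s ℕ.+ x)) ≡ G (+ x)
    periodic x = indicator-cong _ _ (≈-trans (≈-sym (s+x≈x x))) (≈-trans (s+x≈x x))
    one : ∀ N → 0 < N → N ≡ s → sumBelow N (λ x → G (+ x)) ≡ 1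
    one (suc N) 0<N N≡s = cong₂ ℕ._+_ (indicator-yes (0ℤ ≈? 0ℤ [mod s ]) ≈-refl)
      (sumBelow-zero N _ (λ x x<N → indicator-no (+ suc x ≈? 0ℤ [mod s ])
        (λ h → contradiction (residues-≈⇒≡ (subst (suc x <_) N≡s (ℕ.s<s x<N)) (subst (0 <_) N≡s 0<N) h) (λ ()))))

  vectors-divisible : ∀ n d → d ≤ m → sumOver (vectors n) (λ y → indicator (divisible? d y)) ≡ (p ^ (m ∸ d)) ^ n
  vectors-divisible zero    d d≤m = cong (ℕ._+ 0) (indicator-yes (divisible? d _) (λ ()))
  vectors-divisible (suc n) d d≤m = begin
    sumOver (vectors (suc n)) (λ y → indicator (divisible? d y))
      ≡⟨ sumOver-allFuns residues n _ ⟩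
    sumOver residues (λ x → sumOver (vectors n) (λ y → indicator (divisible? d (x ∷ᶠ y))))
      ≡⟨ sumOver-cong residues (λ x → trans (sumOver-cong (vectors n) (split x)) (sumOver-*ʳ (vectors n) _ (indicator (x ≈? 0ℤ [mod p ^ d ])))) ⟩
    sumOver residues (λ x → N ℕ.* indicator (x ≈? 0ℤ [mod p ^ d ]))
      ≡⟨ sumOver-cong residues (λ x → ℕₚ.*-comm N _) ⟩
    sumOver residues (λ x → indicator (x ≈? 0ℤ [mod p ^ d ]) ℕ.* N)
      ≡⟨ sumOver-*ʳ residues _ N ⟩
    sumOver residues (λ x → indicator (x ≈? 0ℤ [mod p ^ d ])) ℕ.* N
      ≡⟨ cong₂ ℕ._*_ (residues-divisible d d≤m) (vectors-divisible n d d≤m) ⟩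
    (p ^ (m ∸ d)) ^ suc n ∎
    where
    open ≡-Reasoning
    N = sumOver (vectors n) (λ y → indicator (divisible? d y))
    split : ∀ x y → indicator (divisible? d (x ∷ᶠ y)) ≡ indicator (divisible? d y) ℕ.* indicator (x ≈? 0ℤ [mod p ^ d ])
    split x y with x ≈? 0ℤ [mod p ^ d ]
    ... | yes x≈0 = trans (indicator-cong (divisible? d (x ∷ᶠ y)) (divisible? d y) (_∘ suc) (λ h → λ { zero → x≈0 ; (suc i) → h i }))
                      (sym (ℕₚ.*-identityʳ _))
    ... | no x≉0  = trans (indicator-no (divisible? d (x ∷ᶠ y)) (λ h → x≉0 (h zero))) (sym (ℕₚ.*-zeroʳ (indicator (divisible? d y))))

  scale-divisible : ∀ n a b → a ≤ b → b ≤ m →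
    sumOver (vectors n) (λ z → indicator (divisible? b (scale a z))) ≡ (p ^ (m ∸ (b ∸ a))) ^ n
  scale-divisible n a b a≤b b≤m = trans
    (sumOver-cong (vectors n) (λ z → indicator-cong (divisible? b (scale a z)) (divisible? (b ∸ a) z)
      (λ h j → down z j (h j)) (λ h j → up z j (h j))))
    (vectors-divisible n (b ∸ a) (ℕₚ.≤-trans (ℕₚ.m∸n≤m b a) b≤m))
    where
    p^b≡ : + (p ^ b) ≡ + (p ^ a) * + (p ^ (b ∸ a))
    p^b≡ = trans (cong (λ k → + (p ^ k)) (sym (ℕₚ.m+[n∸m]≡n a≤b)))
      (trans (cong +_ (ℕₚ.^-distribˡ-+-* p a (b ∸ a))) (ℤₚ.pos-* (p ^ a) (p ^ (b ∸ a))))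
    down : ∀ (z : Vecℤ n) j → scale a z j ≈ 0ℤ [mod p ^ b ] → z j ≈ 0ℤ [mod p ^ (b ∸ a) ]
    down z j ⟪ h ⟫ = ⟪ *-cancelˡ-∣ (+ (p ^ a)) {{ℕₚ.m^n≢0 p a}} (subst (_∣ _) p^b≡ (subst (+ (p ^ b) ∣_) (eq (+ (p ^ a)) (z j)) h)) ⟫
      where
      eq : ∀ a z → a * z - 0ℤ ≡ a * (z - 0ℤ)
      eq = solve-∀
    up : ∀ (z : Vecℤ n) j → z j ≈ 0ℤ [mod p ^ (b ∸ a) ] → scale a z j ≈ 0ℤ [mod p ^ b ]
    up z j h = subst (λ x → x ≈ 0ℤ [mod p ^ b ]) (sym eq) (multiple-≈0 (p ^ b) s)
      where
      s = _∣_.quotient (∣diff h)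
      eq′ : ∀ a s r → a * (s * r) ≡ s * (a * r)
      eq′ = solve-∀
      eq : scale a z j ≡ s * + (p ^ b)
      eq = trans (cong (+ (p ^ a) *_) (≈0⇒multiple h)) (trans (eq′ (+ (p ^ a)) s (+ (p ^ (b ∸ a)))) (cong (s *_) (sym p^b≡)))

  valuationCount-top : ∀ n a → a ≤ m → valuationCount n a m ≡ (p ^ (m ∸ (m ∸ a))) ^ suc n
  valuationCount-top n a a≤m = trans
    (sumOver-cong (vectors (suc n)) (λ z → indicator-cong (valuation? (scale a z) m) (divisible? m (scale a z)) divisible
      (λ h → record { a≤m = ℕₚ.≤-refl ; divisible = h ; maximal = λ m<m → contradiction refl (ℕₚ.<⇒≢ m<m) })))
    (scale-divisible (suc n) a m a≤m ℕₚ.≤-refl)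

  -- Divisibility by p ^ b splits into valuation exactly b and divisibility by p ^ (b + 1). The
  -- identity is additive so that it stays within natural numbers.
  valuationCount-below : ∀ n a b → a ≤ b → b < m →
    valuationCount n a b ℕ.+ (p ^ (m ∸ suc (b ∸ a))) ^ suc n ≡ (p ^ (m ∸ (b ∸ a))) ^ suc n
  valuationCount-below n a b a≤b b<m = begin
    valuationCount n a b ℕ.+ (p ^ (m ∸ suc (b ∸ a))) ^ suc n
      ≡⟨ cong (λ k → valuationCount n a b ℕ.+ (p ^ (m ∸ k)) ^ suc n) (ℕₚ.+-∸-assoc 1 a≤b) ⟨
    valuationCount n a b ℕ.+ (p ^ (m ∸ (suc b ∸ a))) ^ suc n
      ≡⟨ cong (valuationCount n a b ℕ.+_) (scale-divisible (suc n) a (suc b) (ℕₚ.m≤n⇒m≤1+n a≤b) b<m) ⟨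
    valuationCount n a b ℕ.+ sumOver (vectors (suc n)) (λ z → indicator (divisible? (suc b) (scale a z)))
      ≡⟨ sumOver-+ (vectors (suc n)) _ _ ⟨
    sumOver (vectors (suc n)) (λ z → indicator (valuation? (scale a z) b) ℕ.+ indicator (divisible? (suc b) (scale a z)))
      ≡⟨ sumOver-cong (vectors (suc n)) (λ z → split (scale a z)) ⟩
    sumOver (vectors (suc n)) (λ z → indicator (divisible? b (scale a z)))
      ≡⟨ scale-divisible (suc n) a b a≤b (ℕₚ.<⇒≤ b<m) ⟩
    (p ^ (m ∸ (b ∸ a))) ^ suc n ∎
    where
    open ≡-Reasoning
    split : ∀ (z : Vecℤ (suc n)) → indicator (valuation? z b) ℕ.+ indicator (divisible? (suc b) z) ≡ indicator (divisible? b z)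
    split z with divisible? (suc b) z
    ... | yes h = trans (cong (ℕ._+ 1) (indicator-no (valuation? z b) (λ V → maximal V b<m h)))
                    (sym (indicator-yes (divisible? b z) (Divisible-weaken (ℕₚ.n≤1+n b) h)))
    ... | no ¬h = trans (ℕₚ.+-identityʳ _) (indicator-cong (valuation? z b) (divisible? b z) divisible
                    (λ h → record { a≤m = ℕₚ.<⇒≤ b<m ; divisible = h ; maximal = λ _ → ¬h }))

  sumOver-allMats : ∀ n (F : Matℤ n → ℕ) → (∀ {X X′} → (∀ i → X i ≋ X′ i [mod p ^ m ]) → F X ≡ F X′) →
    sumOver (allMats (p ^ m) n) (F ∘ toMatℤ) ≡ sumOver (matrices n n) F
  sumOver-allMats n F F-resp = sumOver-allFuns-map (λ v w → v ≋ w [mod p ^ m ]) (λ _ _ → ≈-refl)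
    (allFuns (allFinL (p ^ m)) n) (vectors n) (λ v i → + toℕ (v i))
    (λ G → sumOver-allFuns-map (λ x y → x ≈ y [mod p ^ m ]) (λ _ → ≈-refl) (allFinL (p ^ m)) residues (λ i → + toℕ i)
      (λ H _ → sym (sumOver-map (λ i → + toℕ i) (allFinL (p ^ m)) H)) n G)
    n F F-resp

-- Partial products

ι : ℕ → ℚ
ι n = + n ℚ./ 1

toℚᵘ-/ : ∀ i n .{{_ : NonZero n}} → toℚᵘ (i ℚ./ n) ℚᵘ.≃ i ℚᵘ./ n
toℚᵘ-/ i (suc n) = ℚₚ.toℚᵘ-fromℚᵘ (ℚᵘ.mkℚᵘ i n)

ι-* : ∀ a b → ι (a ℕ.* b) ≡ ι a ℚ.* ι b
ι-* a b = ℚₚ.toℚᵘ-injective (ℚᵘₚ.≃-trans (toℚᵘ-/ (+ (a ℕ.* b)) 1) (ℚᵘₚ.≃-sym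
  (ℚᵘₚ.≃-trans (ℚₚ.toℚᵘ-homo-* (ι a) (ι b)) (ℚᵘₚ.≃-trans (ℚᵘₚ.*-cong (toℚᵘ-/ (+ a) 1) (toℚᵘ-/ (+ b) 1))
    (ℚᵘ.*≡* (cong (ℤ._* + 1) (sym (ℤₚ.pos-* a b))))))))

ι-+ : ∀ a b → ι (a ℕ.+ b) ≡ ι a ℚ.+ ι b
ι-+ a b = ℚₚ.toℚᵘ-injective (ℚᵘₚ.≃-trans (toℚᵘ-/ (+ (a ℕ.+ b)) 1) (ℚᵘₚ.≃-sym
  (ℚᵘₚ.≃-trans (ℚₚ.toℚᵘ-homo-+ (ι a) (ι b)) (ℚᵘₚ.≃-trans (ℚᵘₚ.+-cong (toℚᵘ-/ (+ a) 1) (toℚᵘ-/ (+ b) 1))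
    (ℚᵘ.*≡* (trans (eq (+ a) (+ b)) (cong (ℤ._* + 1) (sym (ℤₚ.pos-+ a b)))))))))
  where
  eq : ∀ a b → (a ℤ.* ℤ.1ℤ ℤ.+ b ℤ.* ℤ.1ℤ) ℤ.* ℤ.1ℤ ≡ (a ℤ.+ b) ℤ.* ℤ.1ℤ
  eq = solve-∀

/-*-ι : ∀ i n .{{_ : NonZero n}} → (i ℚ./ n) ℚ.* ι n ≡ i ℚ./ 1
/-*-ι i n@(suc _) = ℚₚ.toℚᵘ-injective (ℚᵘₚ.≃-trans (ℚₚ.toℚᵘ-homo-* (i ℚ./ n) (ι n))
  (ℚᵘₚ.≃-trans (ℚᵘₚ.*-cong (toℚᵘ-/ i n) (toℚᵘ-/ (+ n) 1)) (ℚᵘₚ.≃-trans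
    (ℚᵘ.*≡* (trans (eq i (+ n)) (cong (λ d → i ℤ.* + d) (sym (ℕₚ.*-identityʳ n))))) (ℚᵘₚ.≃-sym (toℚᵘ-/ i 1)))))
  where
  eq : ∀ i n → i ℤ.* n ℤ.* ℤ.1ℤ ≡ i ℤ.* n
  eq = solve-∀

ι-nonNeg : ∀ n → ℚ.NonNegative (ι n)
ι-nonNeg n = ℚₚ.normalize-nonNeg n 1

ι-pos : ∀ n .{{_ : NonZero n}} → ℚ.Positive (ι n)
ι-pos n = ℚₚ.normalize-pos n 1

p≤p+q : ∀ x {y} → 0ℚ ℚ.≤ y → x ℚ.≤ x ℚ.+ y
p≤p+q x 0≤y = ℚₚ.≤-trans (ℚₚ.≤-reflexive (sym (ℚₚ.+-identityʳ x))) (ℚₚ.+-monoʳ-≤ x 0≤y)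

p≤q⇒0≤q-p : ∀ {x y} → x ℚ.≤ y → 0ℚ ℚ.≤ y ℚ.- x
p≤q⇒0≤q-p {x} {y} x≤y = subst (ℚ._≤ y ℚ.- x) (ℚₚ.+-inverseʳ x) (ℚₚ.+-monoˡ-≤ (ℚ.- x) x≤y)

ι-mono-≤ : ∀ {a b} → a ≤ b → ι a ℚ.≤ ι b
ι-mono-≤ {a} {b} a≤b = subst (ι a ℚ.≤_) (trans (sym (ι-+ a (b ∸ a))) (cong ι (ℕₚ.m+[n∸m]≡n a≤b)))
  (p≤p+q (ι a) (ℚₚ.nonNegative⁻¹ (ι (b ∸ a)) {{ι-nonNeg (b ∸ a)}}))

ι-mono-< : ∀ {a b} → a < b → ι a ℚ.< ι b
ι-mono-< {a} {b} a<b = ℚₚ.<-≤-trans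
  (subst (ℚ._< ι (suc a)) (ℚₚ.+-identityˡ (ι a)) (subst (0ℚ ℚ.+ ι a ℚ.<_) (sym (ι-+ 1 a)) (ℚₚ.+-monoˡ-< (ι a) (ℚₚ.positive⁻¹ (ι 1) {{ι-pos 1}}))))
  (ι-mono-≤ a<b)

*-cancelʳ-pos : ∀ r .{{_ : ℚ.Positive r}} {x y} → x ℚ.* r ≡ y ℚ.* r → x ≡ y
*-cancelʳ-pos r eq = ℚₚ.≤-antisym (ℚₚ.*-cancelʳ-≤-pos r (ℚₚ.≤-reflexive eq)) (ℚₚ.*-cancelʳ-≤-pos r (ℚₚ.≤-reflexive (sym eq)))

prodFrom-snoc : ∀ f a K → prodFrom f a (suc K) ≡ prodFrom f a K ℚ.* f (a ℕ.+ suc K)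
prodFrom-snoc f a zero    = cong (λ i → f a ℚ.* f i) (sym (ℕₚ.+-comm a 1))
prodFrom-snoc f a (suc K) = trans (cong (f a ℚ.*_) (prodFrom-snoc f (suc a) K))
  (trans (sym (ℚₚ.*-assoc (f a) _ _)) (cong (λ i → f a ℚ.* prodFrom f (suc a) K ℚ.* f i) (sym (ℕₚ.+-suc a (suc K)))))

nondecreasing⇒≤ : ∀ (L : ℕ → ℚ) → (∀ K → L K ℚ.≤ L (suc K)) → ∀ {K K′} → K ≤ K′ → L K ℚ.≤ L K′
nondecreasing⇒≤ L step {K} {K′} K≤K′ = subst (λ x → L K ℚ.≤ L x) (ℕₚ.m+[n∸m]≡n K≤K′) (go (K′ ∸ K))
  where
  go : ∀ t → L K ℚ.≤ L (K ℕ.+ t)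
  go zero    = ℚₚ.≤-reflexive (cong L (sym (ℕₚ.+-identityʳ K)))
  go (suc t) = subst (λ x → L K ℚ.≤ L x) (sym (ℕₚ.+-suc K t)) (ℚₚ.≤-trans (go t) (step (K ℕ.+ t)))

0≤p≤1⇒*-≤ : ∀ x {y} → 0ℚ ℚ.≤ x → y ℚ.≤ 1ℚ → x ℚ.* y ℚ.≤ x
0≤p≤1⇒*-≤ x 0≤x y≤1 = ℚₚ.≤-trans (ℚₚ.*-monoˡ-≤-nonNeg x {{ℚ.nonNegative 0≤x}} y≤1) (ℚₚ.≤-reflexive (ℚₚ.*-identityʳ x))

0≤-* : ∀ {x y} → 0ℚ ℚ.≤ x → 0ℚ ℚ.≤ y → 0ℚ ℚ.≤ x ℚ.* y
0≤-* {x} {y} 0≤x 0≤y = ℚₚ.≤-trans (ℚₚ.≤-reflexive (sym (ℚₚ.*-zeroʳ x))) (ℚₚ.*-monoˡ-≤-nonNeg x {{ℚ.nonNegative 0≤x}} 0≤y)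

-- The tail of the infinite product

module LimitProducts (p : ℕ) (prime : Prime p) where

  private
    instance
      p≢0 : NonZero p
      p≢0 = prime⇒nonZero prime

    1<p : 1 < p
    1<p = ℕ.nonTrivial⇒n>1 p {{prime⇒nonTrivial prime}}

  P : ℕ → ℚ
  P = pinv p prime

  P-* : ∀ k → P k ℚ.* ι (p ^ k) ≡ 1ℚ
  P-* k = /-*-ι (+ 1) (p ^ k)
    where instance _ = ℕₚ.m^n≢0 p k

  P-pos : ∀ k → ℚ.Positive (P k)
  P-pos k = ℚₚ.normalize-pos 1 (p ^ k)
    where instance _ = ℕₚ.m^n≢0 p k

  0≤P : ∀ k → 0ℚ ℚ.≤ P k
  0≤P k = ℚₚ.<⇒≤ (ℚₚ.positive⁻¹ (P k) {{P-pos k}})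

  P-suc : ∀ k → P (suc k) ℚ.* ι p ≡ P k
  P-suc k = *-cancelʳ-pos (ι (p ^ k)) {{ι-pos (p ^ k) {{ℕₚ.m^n≢0 p k}}}} (begin
    P (suc k) ℚ.* ι p ℚ.* ι (p ^ k)     ≡⟨ ℚₚ.*-assoc (P (suc k)) (ι p) (ι (p ^ k)) ⟩
    P (suc k) ℚ.* (ι p ℚ.* ι (p ^ k))   ≡⟨ cong (P (suc k) ℚ.*_) (ι-* p (p ^ k)) ⟨
    P (suc k) ℚ.* ι (p ^ suc k)         ≡⟨ P-* (suc k) ⟩
    1ℚ                                  ≡⟨ P-* k ⟨
    P k ℚ.* ι (p ^ k)                   ∎)
    where open ≡-Reasoning

  P-halves : ∀ k → P (suc k) ℚ.+ P (suc k) ℚ.≤ P k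
  P-halves k = begin
    P (suc k) ℚ.+ P (suc k)                 ≡⟨ cong₂ ℚ._+_ (ℚₚ.*-identityʳ (P (suc k))) (ℚₚ.*-identityʳ (P (suc k))) ⟨
    P (suc k) ℚ.* 1ℚ ℚ.+ P (suc k) ℚ.* 1ℚ   ≡⟨ ℚₚ.*-distribˡ-+ (P (suc k)) 1ℚ 1ℚ ⟨
    P (suc k) ℚ.* ι 2                       ≤⟨ ℚₚ.*-monoˡ-≤-nonNeg (P (suc k)) {{ℚ.nonNegative (0≤P (suc k))}} (ι-mono-≤ 1<p) ⟩
    P (suc k) ℚ.* ι p                       ≡⟨ P-suc k ⟩
    P k                                     ∎
    where open ℚₚ.≤-Reasoning

  P≤1 : ∀ k → P k ℚ.≤ 1ℚ
  P≤1 zero    = ℚₚ.≤-refl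
  P≤1 (suc k) = ℚₚ.≤-trans (p≤p+q (P (suc k)) (0≤P (suc k))) (ℚₚ.≤-trans (P-halves k) (P≤1 k))

  n<p^n : ∀ n → n < p ^ n
  n<p^n zero    = ℕ.z<s
  n<p^n (suc n) = ℕₚ.≤-<-trans (n<p^n n) (ℕₚ.^-monoʳ-< p 1<p (ℕₚ.n<1+n n))

  -- For ε = (k + 1) / d and n ≥ d: P n · d < P n · pⁿ = 1 ≤ k + 1 = ε · d, since n < pⁿ.
  P<ε : ∀ ε → ℚ.Positive ε → ∀ n → ℚ.↧ₙ ε ≤ n → P n ℚ.< ε
  P<ε ε@(ℚ.mkℚ (+ suc k) d-1 _) _ n d≤n = ℚₚ.*-cancelʳ-<-nonNeg (ι d) {{ι-nonNeg d}} (begin-strict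
    P n ℚ.* ι d          <⟨ ℚₚ.*-monoʳ-<-pos (P n) {{P-pos n}} (ι-mono-< (ℕₚ.≤-<-trans d≤n (n<p^n n))) ⟩
    P n ℚ.* ι (p ^ n)    ≡⟨ P-* n ⟩
    1ℚ                   ≤⟨ ι-mono-≤ (ℕ.s≤s (ℕ.z≤n {k})) ⟩
    ι (suc k)            ≡⟨ /-*-ι (+ suc k) d ⟨
    + suc k ℚ./ d ℚ.* ι d ≡⟨ cong (ℚ._* ι d) (ℚₚ.↥p/↧p≡p ε) ⟩
    ε ℚ.* ι d            ∎)
    where
    open ℚₚ.≤-Reasoning
    d = suc d-1

  factor : ℕ → ℚ
  factor i = 1ℚ ℚ.- P (suc i)

  0≤factor : ∀ i → 0ℚ ℚ.≤ factor i
  0≤factor i = p≤q⇒0≤q-p (P≤1 (suc i))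

  factor≤1 : ∀ i → factor i ℚ.≤ 1ℚ
  factor≤1 i = ℚₚ.≤-trans (ℚₚ.+-monoʳ-≤ 1ℚ (ℚₚ.neg-antimono-≤ (0≤P (suc i)))) (ℚₚ.≤-reflexive (ℚₚ.+-identityʳ 1ℚ))

  module _ (a : ℕ) where

    partial : ℕ → ℚ
    partial = prodFrom factor a

    0≤partial : ∀ K → 0ℚ ℚ.≤ partial K
    0≤partial zero    = 0≤factor a
    0≤partial (suc K) = subst (0ℚ ℚ.≤_) (sym (prodFrom-snoc factor a K)) (0≤-* (0≤partial K) (0≤factor (a ℕ.+ suc K)))

    partial-step : ∀ K → partial (suc K) ℚ.≤ partial K
    partial-step K = subst (ℚ._≤ partial K) (sym (prodFrom-snoc factor a K)) (0≤p≤1⇒*-≤ (partial K) (0≤partial K) (factor≤1 (a ℕ.+ suc K)))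

    partial≤1 : ∀ K → partial K ℚ.≤ 1ℚ
    partial≤1 zero    = factor≤1 a
    partial≤1 (suc K) = ℚₚ.≤-trans (partial-step K) (partial≤1 K)

    -- Telescoping this from K on bounds the tail of the infinite product by P (suc (a + K)).
    lower-step : ∀ K → partial K ℚ.- P (suc (a ℕ.+ K)) ℚ.≤ partial (suc K) ℚ.- P (suc (a ℕ.+ suc K))
    lower-step K rewrite ℕₚ.+-suc a K = begin
      -- As p is at least 2, P s covers two copies of P s′: one pays for the new factor, because
      -- `partial K` is at most 1, and the other is the next bound.
      partial K ℚ.- P s                                 ≤⟨ ℚₚ.+-monoʳ-≤ (partial K) (ℚₚ.neg-antimono-≤ (P-halves s)) ⟩
      partial K ℚ.- (P s′ ℚ.+ P s′)                     ≡⟨ eq₁ (partial K) (P s′) ⟩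
      partial K ℚ.- P s′ ℚ.- P s′                       ≤⟨ ℚₚ.+-monoˡ-≤ (ℚ.- P s′) (ℚₚ.+-monoʳ-≤ (partial K) (ℚₚ.neg-antimono-≤ partial*P≤P)) ⟩
      partial K ℚ.- P s′ ℚ.* partial K ℚ.- P s′         ≡⟨ cong (ℚ._- P s′) (eq₂ (partial K) (P s′)) ⟩
      partial K ℚ.* (1ℚ ℚ.- P s′) ℚ.- P s′              ≡⟨ cong (λ i → partial K ℚ.* (1ℚ ℚ.- P (suc i)) ℚ.- P s′) (ℕₚ.+-suc a K) ⟨
      partial K ℚ.* factor (a ℕ.+ suc K) ℚ.- P s′       ≡⟨ cong (ℚ._- P s′) (prodFrom-snoc factor a K) ⟨
      partial (suc K) ℚ.- P s′                          ∎
      where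
      open ℚₚ.≤-Reasoning
      s = suc (a ℕ.+ K)
      s′ = suc s
      partial*P≤P : P s′ ℚ.* partial K ℚ.≤ P s′
      partial*P≤P = 0≤p≤1⇒*-≤ (P s′) (0≤P s′) (partial≤1 K)
      open +-*-Solver
      eq₁ : ∀ x y → x ℚ.- (y ℚ.+ y) ≡ x ℚ.- y ℚ.- y
      eq₁ = solve 2 (λ x y → x :- (y :+ y) := x :- y :- y) refl
      eq₂ : ∀ x y → x ℚ.- y ℚ.* x ≡ x ℚ.* (1ℚ ℚ.- y)
      eq₂ = solve 2 (λ x y → x :- y :* x := x :* (con 1ℚ :- y)) refl

    -- The constant c stands for the finite product of powers of p shared by all partial products;
    -- lying between 0 and 1, it cannot enlarge the difference.
    partial-close : ∀ {K K′} → K ≤ K′ → ∀ c → 0ℚ ℚ.≤ c → c ℚ.≤ 1ℚ →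
      ℚ.∣ partial K ℚ.* c ℚ.- partial K′ ℚ.* c ∣ ℚ.≤ P (suc (a ℕ.+ K))
    partial-close {K} {K′} K≤K′ c 0≤c c≤1 = begin
      ℚ.∣ partial K ℚ.* c ℚ.- partial K′ ℚ.* c ∣   ≡⟨ cong ℚ.∣_∣ (eq₁ (partial K) (partial K′) c) ⟩
      ℚ.∣ (partial K ℚ.- partial K′) ℚ.* c ∣       ≡⟨ ℚₚ.0≤p⇒∣p∣≡p (0≤-* 0≤diff 0≤c) ⟩
      (partial K ℚ.- partial K′) ℚ.* c             ≤⟨ 0≤p≤1⇒*-≤ _ 0≤diff c≤1 ⟩
      partial K ℚ.- partial K′                     ≤⟨ ℚₚ.+-monoʳ-≤ (partial K) (ℚₚ.neg-antimono-≤ lower) ⟩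
      partial K ℚ.- (partial K ℚ.- P s)            ≡⟨ eq₂ (partial K) (P s) ⟩
      P s                                          ∎
      where
      open ℚₚ.≤-Reasoning
      s = suc (a ℕ.+ K)
      decreasing : ∀ {K K′} → K ≤ K′ → ℚ.- partial K ℚ.≤ ℚ.- partial K′
      decreasing = nondecreasing⇒≤ (λ K → ℚ.- partial K) (λ K → ℚₚ.neg-antimono-≤ (partial-step K))
      0≤diff : 0ℚ ℚ.≤ partial K ℚ.- partial K′
      0≤diff = subst (ℚ._≤ partial K ℚ.- partial K′) (ℚₚ.+-inverseʳ (partial K)) (ℚₚ.+-monoʳ-≤ (partial K) (decreasing K≤K′))
      lower : partial K ℚ.- P s ℚ.≤ partial K′
      lower = ℚₚ.≤-trans (nondecreasing⇒≤ (λ K → partial K ℚ.- P (suc (a ℕ.+ K))) lower-step K≤K′)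
        (ℚₚ.≤-trans (ℚₚ.+-monoʳ-≤ (partial K′) (ℚₚ.neg-antimono-≤ (0≤P (suc (a ℕ.+ K′))))) (ℚₚ.≤-reflexive (ℚₚ.+-identityʳ (partial K′))))
      open +-*-Solver
      eq₁ : ∀ x y c → x ℚ.* c ℚ.- y ℚ.* c ≡ (x ℚ.- y) ℚ.* c
      eq₁ = solve 3 (λ x y c → x :* c :- y :* c := (x :- y) :* c) refl
      eq₂ : ∀ x y → x ℚ.- (x ℚ.- y) ≡ y
      eq₂ = solve 2 (λ x y → x :- (x :- y) := y) refl

-- The probability of a partition

sumOver-applyUpTo : ∀ {A : Set} (f : ℕ → A) n F → sumOver (applyUpTo f n) F ≡ sumBelow n (F ∘ f)
sumOver-applyUpTo f zero    F = refl
sumOver-applyUpTo f (suc n) F = cong (F (f 0) ℕ.+_) (sumOver-applyUpTo (f ∘ suc) n F)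

^-distribʳ-* : ∀ n a b → (a ℕ.* b) ^ n ≡ a ^ n ℕ.* b ^ n
^-distribʳ-* zero    a b = refl
^-distribʳ-* (suc n) a b = trans (cong (a ℕ.* b ℕ.*_) (^-distribʳ-* n a b)) (eq a b (a ^ n) (b ^ n))
  where
  eq : ∀ a b x y → a ℕ.* b ℕ.* (x ℕ.* y) ≡ a ℕ.* x ℕ.* (b ℕ.* y)
  eq = solveℕ-∀

module Partition (ℓ m : ℕ) (1≤m : 1 ≤ m) (lam : ℕ → ℕ) (lam₀≡0 : lam 0 ≡ 0)
  (lam-step : ∀ i → i < ℓ → lam i ≤ lam (suc i)) (lamₗ≤m : lam ℓ ≤ m) where

  ℓ∸r≡suc : ∀ {r} → r < ℓ → ℓ ∸ r ≡ suc (ℓ ∸ suc r)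
  ℓ∸r≡suc r<ℓ = ℕₚ.+-∸-assoc 1 r<ℓ

  ℓ≤r⇒lam≡0 : ∀ {r} → ℓ ≤ r → lam (ℓ ∸ r) ≡ 0
  ℓ≤r⇒lam≡0 ℓ≤r = trans (cong lam (ℕₚ.m≤n⇒m∸n≡0 ℓ≤r)) lam₀≡0

  lam∸-step : ∀ r → lam (ℓ ∸ suc r) ≤ lam (ℓ ∸ r)
  lam∸-step r with r ℕ.<? ℓ
  ... | yes r<ℓ = subst (λ k → lam (ℓ ∸ suc r) ≤ lam k) (sym (ℓ∸r≡suc r<ℓ))
                    (lam-step (ℓ ∸ suc r) (subst (_≤ ℓ) (ℓ∸r≡suc r<ℓ) (ℕₚ.m∸n≤m ℓ r)))
  ... | no r≮ℓ  = subst (_≤ lam (ℓ ∸ r)) (sym (ℓ≤r⇒lam≡0 (ℕₚ.m≤n⇒m≤1+n (ℕₚ.≮⇒≥ r≮ℓ)))) ℕ.z≤n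

  lam∸≤m : ∀ r → lam (ℓ ∸ r) ≤ m
  lam∸≤m zero    = lamₗ≤m
  lam∸≤m (suc r) = ℕₚ.≤-trans (lam∸-step r) (lam∸≤m r)

  lam≤m : ∀ {k} → k ≤ ℓ → lam k ≤ m
  lam≤m {k} k≤ℓ = subst (λ x → lam x ≤ m) (ℕₚ.m∸[m∸n]≡n k≤ℓ) (lam∸≤m (ℓ ∸ k))

  -- The last r terms of …, 0, 0, λ₁, …, λₗ (for r > ℓ the truncated ℓ ∸ r points at λ₀ = 0).
  lastParts : ∀ r → Fin r → ℕ
  lastParts zero    = λ ()
  lastParts (suc r) = lam (ℓ ∸ r) ∷ᶠ lastParts r

  lastParts-lower : ∀ r i → lam (ℓ ∸ r) ≤ lastParts r i
  lastParts-lower (suc r) zero    = lam∸-step r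
  lastParts-lower (suc r) (suc i) = ℕₚ.≤-trans (lam∸-step r) (lastParts-lower r i)

  lastParts-nondecreasing : ∀ r → NonDecreasing (lastParts r)
  lastParts-nondecreasing zero    = tt
  lastParts-nondecreasing (suc r) = lastParts-lower r , lastParts-nondecreasing r

  lastParts≡lam : ∀ r → r ≤ ℓ → ∀ i → lastParts r i ≡ lam (suc (ℓ ∸ r) ℕ.+ toℕ i)
  lastParts≡lam (suc r) r<ℓ zero    = cong lam (trans (ℓ∸r≡suc r<ℓ) (sym (ℕₚ.+-identityʳ _)))
  lastParts≡lam (suc r) r<ℓ (suc i) = trans (lastParts≡lam r (ℕₚ.<⇒≤ r<ℓ) i)
    (cong lam (trans (sym (ℕₚ.+-suc (ℓ ∸ r) (toℕ i))) (cong (ℕ._+ suc (toℕ i)) (ℓ∸r≡suc r<ℓ))))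

  lastParts-ℓ : lastParts ℓ ≗ λ i → lam (suc (toℕ i))
  lastParts-ℓ i = trans (lastParts≡lam ℓ ℕₚ.≤-refl i) (cong (λ k → lam (suc k ℕ.+ toℕ i)) (ℕₚ.n∸n≡0 ℓ))

  -- The parts equal to m

  topCount : ℕ → ℕ
  topCount k = sumBelow k (λ x → indicator (lam (suc x) ℕ.≟ m))

  i₀≡topCount : i₀ ℓ m lam ≡ topCount ℓ
  i₀≡topCount = trans (length-filter (λ i → lam i ℕ.≟ m) (map suc (upTo ℓ)))
    (trans (sumOver-map suc (upTo ℓ) _) (sumOver-applyUpTo id ℓ _))

  indicator≤1 : ∀ {A : Set} (A? : Dec A) → indicator A? ≤ 1
  indicator≤1 (yes _) = ℕₚ.≤-refl
  indicator≤1 (no _)  = ℕ.z≤n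

  topCount-≤ : ∀ k r → topCount (k ℕ.+ r) ≤ topCount k ℕ.+ r
  topCount-≤ k zero    = ℕₚ.≤-reflexive (trans (cong topCount (ℕₚ.+-identityʳ k)) (sym (ℕₚ.+-identityʳ (topCount k))))
  topCount-≤ k (suc r) = begin
    topCount (k ℕ.+ suc r)                                               ≡⟨ cong topCount (ℕₚ.+-suc k r) ⟩
    topCount (suc (k ℕ.+ r))                                             ≡⟨ sumBelow-last (k ℕ.+ r) _ ⟩
    topCount (k ℕ.+ r) ℕ.+ indicator (lam (suc (k ℕ.+ r)) ℕ.≟ m)         ≤⟨ ℕₚ.+-mono-≤ (topCount-≤ k r) (indicator≤1 _) ⟩
    topCount k ℕ.+ r ℕ.+ 1                                               ≡⟨ trans (ℕₚ.+-assoc (topCount k) r 1) (cong (topCount k ℕ.+_) (ℕₚ.+-comm r 1)) ⟩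
    topCount k ℕ.+ suc r                                                 ∎
    where open ℕₚ.≤-Reasoning

  top-suc : ∀ {k} → k < ℓ → lam k ≡ m → lam (suc k) ≡ m
  top-suc {k} k<ℓ lamₖ≡m = ℕₚ.≤-antisym (lam≤m k<ℓ) (subst (_≤ lam (suc k)) lamₖ≡m (lam-step k k<ℓ))

  topCount-full : ∀ k r → k ℕ.+ r ≤ ℓ → lam k ≡ m → topCount (k ℕ.+ r) ≡ topCount k ℕ.+ r × lam (k ℕ.+ r) ≡ m
  topCount-full k zero    h lamₖ≡m rewrite ℕₚ.+-identityʳ k = sym (ℕₚ.+-identityʳ (topCount k)) , lamₖ≡m
  topCount-full k (suc r) h lamₖ≡m rewrite ℕₚ.+-suc k r with topCount-full k r (ℕₚ.<⇒≤ h) lamₖ≡m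
  ... | eq , top = trans (sumBelow-last (k ℕ.+ r) _) (trans (cong₂ ℕ._+_ eq (indicator-yes (lam (suc (k ℕ.+ r)) ℕ.≟ m) (top-suc h top)))
                     (trans (ℕₚ.+-assoc (topCount k) r 1) (cong (topCount k ℕ.+_) (ℕₚ.+-comm r 1)))) , top-suc h top

  topCount-empty : ∀ k → k ≤ ℓ → lam k ≢ m → topCount k ≡ 0
  topCount-empty zero    _   _      = refl
  topCount-empty (suc k) k<ℓ lam≢m = trans (sumBelow-last k _)
    (cong₂ ℕ._+_ (topCount-empty k (ℕₚ.<⇒≤ k<ℓ) (lam≢m ∘ top-suc k<ℓ)) (indicator-no (lam (suc k) ℕ.≟ m) lam≢m))

  -- By monotonicity λ at ℓ - r being m forces the r parts after it to be m too, which makes r + 1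
  -- of them. For r ≥ ℓ the value is λ₀ = 0, and m ≥ 1 excludes it.
  top⇒r<i₀ : ∀ r → lam (ℓ ∸ r) ≡ m → r < i₀ ℓ m lam
  top⇒r<i₀ r top with r ℕ.<? ℓ
  ... | no r≮ℓ  = contradiction (trans (sym (ℓ≤r⇒lam≡0 (ℕₚ.≮⇒≥ r≮ℓ))) top) (ℕₚ.<⇒≢ 1≤m)
  ... | yes r<ℓ = subst (r <_) (sym (begin
      i₀ ℓ m lam                      ≡⟨ i₀≡topCount ⟩
      topCount ℓ                      ≡⟨ cong topCount (sym ℓ≡) ⟩
      topCount (suc k ℕ.+ r)          ≡⟨ proj₁ (topCount-full (suc k) r (ℕₚ.≤-reflexive ℓ≡) top′) ⟩
      topCount (suc k) ℕ.+ r          ≡⟨ cong (ℕ._+ r) (trans (sumBelow-last k _) (cong (topCount k ℕ.+_) (indicator-yes (lam (suc k) ℕ.≟ m) top′))) ⟩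
      topCount k ℕ.+ 1 ℕ.+ r          ≡⟨ ℕₚ.+-assoc (topCount k) 1 r ⟩
      topCount k ℕ.+ suc r            ∎)) (ℕₚ.m≤n+m (suc r) (topCount k))
    where
    open ≡-Reasoning
    k = ℓ ∸ suc r
    ℓ≡ : suc k ℕ.+ r ≡ ℓ
    ℓ≡ = trans (cong (ℕ._+ r) (sym (ℓ∸r≡suc r<ℓ))) (ℕₚ.m∸n+n≡m (ℕₚ.<⇒≤ r<ℓ))
    top′ : lam (suc k) ≡ m
    top′ = trans (cong lam (sym (ℓ∸r≡suc r<ℓ))) top

  i₀≤ℓ : i₀ ℓ m lam ≤ ℓ
  i₀≤ℓ = subst (_≤ ℓ) (sym i₀≡topCount) (topCount-≤ 0 ℓ)

  -- If λ at ℓ - r is below m, so is everything before it, and only the last r parts can equal m.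
  ¬top⇒i₀≤r : ∀ r → lam (ℓ ∸ r) ≢ m → i₀ ℓ m lam ≤ r
  ¬top⇒i₀≤r r ¬top with r ℕ.≤? ℓ
  ... | no r≰ℓ  = ℕₚ.≤-trans i₀≤ℓ (ℕₚ.<⇒≤ (ℕₚ.≰⇒> r≰ℓ))
  ... | yes r≤ℓ = begin
    i₀ ℓ m lam                 ≡⟨ i₀≡topCount ⟩
    topCount ℓ                 ≡⟨ cong topCount (ℕₚ.m∸n+n≡m r≤ℓ) ⟨
    topCount (ℓ ∸ r ℕ.+ r)     ≤⟨ topCount-≤ (ℓ ∸ r) r ⟩
    topCount (ℓ ∸ r) ℕ.+ r     ≡⟨ cong (ℕ._+ r) (topCount-empty (ℓ ∸ r) (ℕₚ.m∸n≤m ℓ r) ¬top) ⟩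
    r                          ∎
    where open ℕₚ.≤-Reasoning

  -- From counts to the limit formula

  module Probability (p : ℕ) (prime : Prime p) where

    open CokernelCounts p prime m hiding (p≢0)
    open LimitProducts p prime

    partsSum : Vecℤ ℓ → Vecℤ ℓ → Set
    partsSum = DirectSum (λ i → lam (suc (toℕ i)))

    -- The extra leading parts are zero, so their summands ℤ/1 are trivial and dropping those
    -- coordinates loses nothing.
    padding : ∀ {r} → ℓ ≤′ r → QuotIso r ℓ (DirectSum (lastParts r)) partsSum
    padding ≤′-refl = id ,
      (λ v w → DirectSum-resp lastParts-ℓ {v} {w}) , (λ _ _ _ → ≈-refl) ,
      (λ v w → DirectSum-resp (λ i → sym (lastParts-ℓ i)) {v} {w}) , (λ y → y , λ _ → ≈-refl)
    padding (≤′-step {r} ℓ≤r) with padding ℓ≤r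
    ... | f , resp , add , inj , surj =
      (λ v → f (v ∘ suc)) , (λ v w h → resp _ _ (h ∘ suc)) , (λ v w → add (v ∘ suc) (w ∘ suc)) ,
      (λ v w h → λ { zero → subst (λ k → v zero ≈ w zero [mod p ^ k ]) (sym (ℓ≤r⇒lam≡0 (ℕₚ.≤′⇒≤ ℓ≤r))) (≈-mod-1 (v zero) (w zero))
                   ; (suc i) → inj _ _ h i }) ,
      (λ y → 0ℤ ∷ᶠ proj₁ (surj y) , proj₂ (surj y))

    SumRel⇒partsSum : ∀ v w → SumRel p ℓ lam v w → partsSum v w
    SumRel⇒partsSum v w h i = ⟪ ∣ᵤ⇒∣ (h i) ⟫

    partsSum⇒SumRel : ∀ v w → partsSum v w → SumRel p ℓ lam v w
    partsSum⇒SumRel v w h i = ∣⇒∣ᵤ (∣diff (h i))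

    module _ {n} (ℓ≤n : ℓ ≤ suc n) (b : Vecℤ (suc n)) (X : Fin (suc n) → Fin (suc n) → Fin (p ^ m)) where

      WalkEvent⇒HasType : WalkEvent p m ℓ lam n b X → HasType (lastParts (suc n)) (toMatℤ X) b
      WalkEvent⇒HasType h = QuotIso-compose {e = lastParts (suc n)}
        (QuotIso-resp (CokerRel⇒Coker (toMatℤ X) b) (Coker⇒CokerRel (toMatℤ X) b) SumRel⇒partsSum partsSum⇒SumRel h)
        (QuotIso-inverse {e = λ i → lam (suc (toℕ i))} (padding (ℕₚ.≤⇒≤′ ℓ≤n)))

      HasType⇒WalkEvent : HasType (lastParts (suc n)) (toMatℤ X) b → WalkEvent p m ℓ lam n b X
      HasType⇒WalkEvent h = QuotIso-resp (Coker⇒CokerRel (toMatℤ X) b) (CokerRel⇒Coker (toMatℤ X) b) partsSum⇒SumRel SumRel⇒partsSum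
        (QuotIso-compose {e = λ i → lam (suc (toℕ i))} h (padding (ℕₚ.≤⇒≤′ ℓ≤n)))

    -- As ℓ ≤ n, the first of the n + 1 padded parts is λ₀ = 0, which is the valuation of b because
    -- p does not divide b.
    eventCount : ∀ {n} → ℓ ≤ n → (b : Vecℤ (suc n)) → ¬ (∀ i → (+ p) ∣ℤ b i) → (dec : Decidable (WalkEvent p m ℓ lam n b)) →
      length (filter dec (allMats (p ^ m) (suc n))) ≡ typeCount (lastParts (suc n))
    eventCount {n} ℓ≤n b b≢0 dec = begin
      length (filter dec (allMats (p ^ m) (suc n)))
        ≡⟨ length-filter dec (allMats (p ^ m) (suc n)) ⟩
      sumOver (allMats (p ^ m) (suc n)) (λ X → indicator (dec X))
        ≡⟨ sumOver-cong (allMats (p ^ m) (suc n)) (λ X → indicator-cong (dec X) (hasType? e nd (toMatℤ X) b)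
             (WalkEvent⇒HasType ℓ≤1+n b X) (HasType⇒WalkEvent ℓ≤1+n b X)) ⟩
      sumOver (allMats (p ^ m) (suc n)) (λ X → indicator (hasType? e nd (toMatℤ X) b))
        ≡⟨ sumOver-allMats (suc n) (λ X → indicator (hasType? e nd X b)) (λ {X} {X′} h → indicator-cong (hasType? e nd X b) (hasType? e nd X′ b)
             (HasType-resp {e = e} (λ _ → refl) h (λ _ → ≈-refl)) (HasType-resp {e = e} (λ _ → refl) (λ i j → ≈-sym (h i j)) (λ _ → ≈-refl))) ⟩
      count e nd b
        ≡⟨ count≡typeCount e nd b (yes valuation-b) ⟩
      1 ℕ.* typeCount e
        ≡⟨ ℕₚ.*-identityˡ (typeCount e) ⟩
      typeCount e ∎
      where
      open ≡-Reasoning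
      e = lastParts (suc n)
      nd = lastParts-nondecreasing (suc n)
      ℓ≤1+n = ℕₚ.m≤n⇒m≤1+n ℓ≤n
      valuation-b : Valuation b (lam (ℓ ∸ n))
      valuation-b = subst (Valuation b) (sym (ℓ≤r⇒lam≡0 ℓ≤n)) (record
        { a≤m = ℕ.z≤n ; divisible = λ j → ≈-mod-1 (b j) 0ℤ
        ; maximal = λ _ h → b≢0 (λ i → subst (+ p ∣ℤ_) (ℤₚ.+-identityʳ (b i)) (subst (λ k → + k ∣ℤ (b i ℤ.- 0ℤ)) (ℕₚ.*-identityʳ p) (∣⇒∣ᵤ (∣diff (h i)))))
        })

    rowFactor : ∀ {k} → Dec (k ≡ m) → ℕ → ℚ
    rowFactor (yes _) r = 1ℚ
    rowFactor (no _)  r = factor r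

    -- The transition probability of the chain times the number of vectors: p ^ (m ∸ d) to the rank
    -- counts the vectors divisible by p ^ d, d = b ∸ a, and below the cap m those divisible once
    -- more are removed.
    ι-valuationCount : ∀ n a b → a ≤ b → b ≤ m → (b≟m : Dec (b ≡ m)) →
      ι (valuationCount n a b) ≡ P (suc n ℕ.* (b ∸ a)) ℚ.* rowFactor b≟m n ℚ.* ι ((p ^ m) ^ suc n)
    ι-valuationCount n a b a≤b b≤m b≟m = trans (main b≟m) (sym (begin
      P d′ ℚ.* rowFactor b≟m n ℚ.* ι ((p ^ m) ^ suc n)            ≡⟨ cong (λ x → P d′ ℚ.* rowFactor b≟m n ℚ.* x) ι-q ⟩
      P d′ ℚ.* rowFactor b≟m n ℚ.* (ι (p ^ d′) ℚ.* ι A)           ≡⟨ eq (P d′) (rowFactor b≟m n) (ι (p ^ d′)) (ι A) ⟩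
      P d′ ℚ.* ι (p ^ d′) ℚ.* (rowFactor b≟m n ℚ.* ι A)           ≡⟨ cong (ℚ._* (rowFactor b≟m n ℚ.* ι A)) (P-* d′) ⟩
      1ℚ ℚ.* (rowFactor b≟m n ℚ.* ι A)                            ≡⟨ ℚₚ.*-identityˡ _ ⟩
      rowFactor b≟m n ℚ.* ι A                                     ∎))
      where
      open ≡-Reasoning
      d = b ∸ a
      d′ = suc n ℕ.* d
      A = (p ^ (m ∸ d)) ^ suc n
      d≤m : d ≤ m
      d≤m = ℕₚ.≤-trans (ℕₚ.m∸n≤m b a) b≤m
      ι-q : ι ((p ^ m) ^ suc n) ≡ ι (p ^ d′) ℚ.* ι A
      ι-q = trans (cong ι (begin
        (p ^ m) ^ suc n                       ≡⟨ ℕₚ.^-*-assoc p m (suc n) ⟩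
        p ^ (m ℕ.* suc n)                     ≡⟨ cong (λ k → p ^ (k ℕ.* suc n)) (ℕₚ.m+[n∸m]≡n d≤m) ⟨
        p ^ ((d ℕ.+ (m ∸ d)) ℕ.* suc n)       ≡⟨ cong (p ^_) (ℕₚ.*-distribʳ-+ (suc n) d (m ∸ d)) ⟩
        p ^ (d ℕ.* suc n ℕ.+ (m ∸ d) ℕ.* suc n) ≡⟨ ℕₚ.^-distribˡ-+-* p (d ℕ.* suc n) ((m ∸ d) ℕ.* suc n) ⟩
        p ^ (d ℕ.* suc n) ℕ.* p ^ ((m ∸ d) ℕ.* suc n)  ≡⟨ cong₂ ℕ._*_ (cong (p ^_) (ℕₚ.*-comm d (suc n))) (sym (ℕₚ.^-*-assoc p (m ∸ d) (suc n))) ⟩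
        p ^ d′ ℕ.* A                          ∎)) (ι-* (p ^ d′) A)
      open +-*-Solver using (solve; _:*_; _:+_; _:-_; _:=_; con)
      eq : ∀ x f y z → x ℚ.* f ℚ.* (y ℚ.* z) ≡ x ℚ.* y ℚ.* (f ℚ.* z)
      eq = solve 4 (λ x f y z → x :* f :* (y :* z) := x :* y :* (f :* z)) refl
      main : (b≟m : Dec (b ≡ m)) → ι (valuationCount n a b) ≡ rowFactor b≟m n ℚ.* ι A
      main (yes refl) = trans (cong ι (valuationCount-top n a a≤b)) (sym (ℚₚ.*-identityˡ (ι A)))
      main (no b≢m)   = begin
        ι V                                           ≡⟨ eq₁ (ι V) (ι A′) ⟩
        (ι V ℚ.+ ι A′) ℚ.- 1ℚ ℚ.* ι A′                ≡⟨ cong₂ (λ x y → x ℚ.- y ℚ.* ι A′) (sym (ι-+ V A′)) (sym (P-* (suc n))) ⟩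
        ι (V ℕ.+ A′) ℚ.- P (suc n) ℚ.* ι (p ^ suc n) ℚ.* ι A′   ≡⟨ cong₂ (λ x y → x ℚ.- y) (cong ι (valuationCount-below n a b a≤b b<m))
                                                             (trans (ℚₚ.*-assoc (P (suc n)) _ _) (cong (P (suc n) ℚ.*_) (trans (sym (ι-* (p ^ suc n) A′)) (cong ι (sym A≡))))) ⟩
        ι A ℚ.- P (suc n) ℚ.* ι A                     ≡⟨ eq₂ (ι A) (P (suc n)) ⟩
        (1ℚ ℚ.- P (suc n)) ℚ.* ι A                    ∎
        where
        V = valuationCount n a b
        A′ = (p ^ (m ∸ suc d)) ^ suc n
        b<m : b < m
        b<m = ℕₚ.≤∧≢⇒< b≤m b≢m
        d<m : d < m
        d<m = ℕₚ.≤-<-trans (ℕₚ.m∸n≤m b a) b<m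
        A≡ : A ≡ p ^ suc n ℕ.* A′
        A≡ = trans (cong (λ k → (p ^ k) ^ suc n) (ℕₚ.+-∸-assoc 1 d<m)) (^-distribʳ-* (suc n) p (p ^ (m ∸ suc d)))
        eq₁ : ∀ x y → x ≡ (x ℚ.+ y) ℚ.- 1ℚ ℚ.* y
        eq₁ = solve 2 (λ x y → x := (x :+ y) :- con 1ℚ :* y) refl
        eq₂ : ∀ x y → x ℚ.- y ℚ.* x ≡ (1ℚ ℚ.- y) ℚ.* x
        eq₂ = solve 2 (λ x y → x :- y :* x := (con 1ℚ :- y) :* x) refl

    rowFactors : ℕ → ℚ
    rowFactors zero    = 1ℚ
    rowFactors (suc r) = rowFactors r ℚ.* rowFactor (lam (ℓ ∸ r) ℕ.≟ m) r

    powers : ℕ → ℚ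
    powers zero    = 1ℚ
    powers (suc r) = powers r ℚ.* P (suc r ℕ.* (lam (ℓ ∸ r) ∸ lam (ℓ ∸ suc r)))

    ι-typeCount : ∀ r → ι (typeCount (lastParts (suc r))) ≡ rowFactors r ℚ.* powers r ℚ.* ι ((p ^ m) ^ (suc r ℕ.* suc r))
    ι-typeCount zero    = sym (ℚₚ.*-identityˡ (ι ((p ^ m) ^ 1)))
    ι-typeCount (suc n) = begin
      ι (q ^ (2 ℕ.+ n) ℕ.* (V ℕ.* T))
        ≡⟨ trans (ι-* (q ^ (2 ℕ.+ n)) (V ℕ.* T)) (cong (ι (q ^ (2 ℕ.+ n)) ℚ.*_) (ι-* V T)) ⟩
      ι (q ^ (2 ℕ.+ n)) ℚ.* (ι V ℚ.* ι T)
        ≡⟨ cong₂ (λ x y → ι (q ^ (2 ℕ.+ n)) ℚ.* (x ℚ.* y)) (ι-valuationCount n a b (lam∸-step n) (lam∸≤m n) (b ℕ.≟ m)) (ι-typeCount n) ⟩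
      ι (q ^ (2 ℕ.+ n)) ℚ.* (w ℚ.* f ℚ.* ι (q ^ suc n) ℚ.* (F ℚ.* H ℚ.* ι (q ^ (suc n ℕ.* suc n))))
        ≡⟨ eq (ι (q ^ (2 ℕ.+ n))) w f (ι (q ^ suc n)) F H (ι (q ^ (suc n ℕ.* suc n))) ⟩
      F ℚ.* f ℚ.* (H ℚ.* w) ℚ.* (ι (q ^ (2 ℕ.+ n)) ℚ.* (ι (q ^ suc n) ℚ.* ι (q ^ (suc n ℕ.* suc n))))
        ≡⟨ cong (F ℚ.* f ℚ.* (H ℚ.* w) ℚ.*_) ι-square ⟨
      F ℚ.* f ℚ.* (H ℚ.* w) ℚ.* ι (q ^ (suc (suc n) ℕ.* suc (suc n))) ∎
      where
      open ≡-Reasoning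
      q = p ^ m
      a = lam (ℓ ∸ suc n)
      b = lam (ℓ ∸ n)
      V = valuationCount n a b
      T = typeCount (lastParts (suc n))
      w = P (suc n ℕ.* (b ∸ a))
      f = rowFactor (b ℕ.≟ m) n
      F = rowFactors n
      H = powers n
      -- The entries of X split into the free row, the vector `next` and the matrix `block`.
      square : ∀ n → suc (suc n) ℕ.* suc (suc n) ≡ (2 ℕ.+ n) ℕ.+ (suc n ℕ.+ suc n ℕ.* suc n)
      square = solveℕ-∀
      ι-square : ι (q ^ (suc (suc n) ℕ.* suc (suc n))) ≡ ι (q ^ (2 ℕ.+ n)) ℚ.* (ι (q ^ suc n) ℚ.* ι (q ^ (suc n ℕ.* suc n)))
      ι-square = trans (cong ι (trans (cong (q ^_) (square n)) (ℕₚ.^-distribˡ-+-* q (2 ℕ.+ n) (suc n ℕ.+ suc n ℕ.* suc n))))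
        (trans (ι-* (q ^ (2 ℕ.+ n)) _) (cong (ι (q ^ (2 ℕ.+ n)) ℚ.*_)
          (trans (cong ι (ℕₚ.^-distribˡ-+-* q (suc n) (suc n ℕ.* suc n))) (ι-* (q ^ suc n) _))))
      open +-*-Solver using (solve; _:*_; _:=_)
      eq : ∀ A w f B F H C → A ℚ.* (w ℚ.* f ℚ.* B ℚ.* (F ℚ.* H ℚ.* C)) ≡ F ℚ.* f ℚ.* (H ℚ.* w) ℚ.* (A ℚ.* (B ℚ.* C))
      eq = solve 7 (λ A w f B F H C → A :* (w :* f :* B :* (F :* H :* C)) := F :* f :* (H :* w) :* (A :* (B :* C))) refl

    weight : ℕ → ℚ
    weight = prod1to (λ j → P (j ℕ.* δ ℓ lam j))

    -- The step at remaining rank j = r + 1 climbs from λ at ℓ - j to λ at ℓ - j + 1, which is by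
    -- δⱼ.
    powers≡weight : ∀ r → r ≤ ℓ → powers r ≡ weight r
    powers≡weight zero    _   = refl
    powers≡weight (suc r) r<ℓ = cong₂ (λ x k → x ℚ.* P (suc r ℕ.* (lam k ∸ lam (ℓ ∸ suc r)))) (powers≡weight r (ℕₚ.<⇒≤ r<ℓ)) (ℓ∸r≡suc r<ℓ)

    powers-stable : ∀ {r} → ℓ ≤′ r → powers r ≡ weight ℓ
    powers-stable ≤′-refl = powers≡weight ℓ ℕₚ.≤-refl
    powers-stable (≤′-step {r} ℓ≤r) = trans (cong₂ (λ x k → x ℚ.* P k) (powers-stable ℓ≤r) exponent≡0) (ℚₚ.*-identityʳ (weight ℓ))
      where
      exponent≡0 : suc r ℕ.* (lam (ℓ ∸ r) ∸ lam (ℓ ∸ suc r)) ≡ 0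
      exponent≡0 = trans (cong (λ x → suc r ℕ.* (x ∸ lam (ℓ ∸ suc r))) (ℓ≤r⇒lam≡0 (ℕₚ.≤′⇒≤ ℓ≤r)))
        (trans (cong (suc r ℕ.*_) (ℕₚ.0∸n≡0 (lam (ℓ ∸ suc r)))) (ℕₚ.*-zeroʳ (suc r)))

    rowFactor-top : ∀ r → r < i₀ ℓ m lam → rowFactor (lam (ℓ ∸ r) ℕ.≟ m) r ≡ 1ℚ
    rowFactor-top r r<i₀ with lam (ℓ ∸ r) ℕ.≟ m
    ... | yes _   = refl
    ... | no ¬top = contradiction (¬top⇒i₀≤r r ¬top) (ℕₚ.<⇒≱ r<i₀)

    rowFactor-below : ∀ r → i₀ ℓ m lam ≤ r → rowFactor (lam (ℓ ∸ r) ℕ.≟ m) r ≡ factor r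
    rowFactor-below r i₀≤r with lam (ℓ ∸ r) ℕ.≟ m
    ... | yes top = contradiction i₀≤r (ℕₚ.<⇒≱ (top⇒r<i₀ r top))
    ... | no _    = refl

    rowFactors-top : ∀ r → r ≤ i₀ ℓ m lam → rowFactors r ≡ 1ℚ
    rowFactors-top zero    _ = refl
    rowFactors-top (suc r) h = trans (cong₂ ℚ._*_ (rowFactors-top r (ℕₚ.<⇒≤ h)) (rowFactor-top r h)) (ℚₚ.*-identityˡ 1ℚ)

    -- The indices below i₀ contribute 1. `prodFrom` with argument K has K + 1 factors, so the
    -- remaining indices are i₀, ..., i₀ + K.
    rowFactors≡partial : ∀ K → rowFactors (i₀ ℓ m lam ℕ.+ suc K) ≡ partial (i₀ ℓ m lam) K
    rowFactors≡partial K rewrite ℕₚ.+-suc (i₀ ℓ m lam) K = go K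
      where
      i = i₀ ℓ m lam
      go : ∀ K → rowFactors (suc (i ℕ.+ K)) ≡ partial i K
      go zero    rewrite ℕₚ.+-identityʳ i = trans (cong₂ ℚ._*_ (rowFactors-top i ℕₚ.≤-refl) (rowFactor-below i ℕₚ.≤-refl)) (ℚₚ.*-identityˡ (factor i))
      go (suc K) = trans (cong₂ ℚ._*_ (trans (cong rowFactors (ℕₚ.+-suc i K)) (go K)) (rowFactor-below (i ℕ.+ suc K) (ℕₚ.m≤m+n i (suc K)))) (sym (prodFrom-snoc factor i K))

    walkProb≡limitPartial : ∀ {n} → ℓ ≤ n → ∀ K → n ≡ i₀ ℓ m lam ℕ.+ suc K →
      (b : Vecℤ (suc n)) → ¬ (∀ i → (+ p) ∣ℤ b i) → (dec : Decidable (WalkEvent p m ℓ lam n b)) →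
      walkProb p prime m ℓ lam n b dec ≡ limitPartial p prime ℓ m lam K
    walkProb≡limitPartial {n} ℓ≤n K n≡ b b≢0 dec = *-cancelʳ-pos (ι Q) {{ι-pos Q}} (begin
      walkProb p prime m ℓ lam n b dec ℚ.* ι Q                    ≡⟨ /-*-ι (+ length (filter dec (allMats (p ^ m) (suc n)))) Q ⟩
      ι (length (filter dec (allMats (p ^ m) (suc n))))           ≡⟨ cong ι (eventCount ℓ≤n b b≢0 dec) ⟩
      ι (typeCount (lastParts (suc n)))                           ≡⟨ ι-typeCount n ⟩
      rowFactors n ℚ.* powers n ℚ.* ι Q                           ≡⟨ cong₂ (λ x y → x ℚ.* y ℚ.* ι Q) (trans (cong rowFactors n≡) (rowFactors≡partial K)) (powers-stable (ℕₚ.≤⇒≤′ ℓ≤n)) ⟩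
      limitPartial p prime ℓ m lam K ℚ.* ι Q                      ∎)
      where
      open ≡-Reasoning
      Q = (p ^ m) ^ (suc n ℕ.* suc n)
      instance
        Q≢0 : NonZero Q
        Q≢0 = ℕₚ.m^n≢0 (p ^ m) (suc n ℕ.* suc n)

    0≤weight : ∀ r → 0ℚ ℚ.≤ weight r
    0≤weight zero    = ℚₚ.nonNegative⁻¹ 1ℚ
    0≤weight (suc r) = 0≤-* (0≤weight r) (0≤P (suc r ℕ.* δ ℓ lam (suc r)))

    weight≤1 : ∀ r → weight r ℚ.≤ 1ℚ
    weight≤1 zero    = ℚₚ.≤-refl
    weight≤1 (suc r) = ℚₚ.≤-trans (0≤p≤1⇒*-≤ (weight r) (0≤weight r) (P≤1 (suc r ℕ.* δ ℓ lam (suc r)))) (weight≤1 r)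

    walkProb-converges : (b : (n : ℕ) → Vecℤ (suc n)) → (∀ n → ¬ (∀ i → (+ p) ∣ℤ b n i)) →
      (dec : ∀ n → Decidable (WalkEvent p m ℓ lam n (b n))) →
      ∀ (ε : ℚ) → ℚ.Positive ε →
      ∃ λ N → ∀ n → N ≤ n → ∃ λ K₀ → ∀ K → K₀ ≤ K →
        ℚ.∣ walkProb p prime m ℓ lam n (b n) (dec n) ℚ.- limitPartial p prime ℓ m lam K ∣ ℚ.< ε
    -- The summand suc ℓ gives n > ℓ ≥ i₀, so that K₀ = n - i₀ - 1 is the index at which the partial
    -- product equals the probability. The denominator of ε makes the tail bound P n smaller than ε.
    walkProb-converges b b≢0 dec ε ε>0 = suc ℓ ℕ.+ ℚ.↧ₙ ε , λ n N≤n → n ∸ suc i , λ K K₀≤K →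
      let ℓ<n = ℕₚ.m+n≤o⇒m≤o (suc ℓ) N≤n
          K₀  = n ∸ suc i
          n≡  : n ≡ suc (i ℕ.+ K₀)
          n≡  = sym (ℕₚ.m+[n∸m]≡n {suc i} (ℕₚ.≤-trans (ℕ.s≤s i₀≤ℓ) ℓ<n))
          open ℚₚ.≤-Reasoning
      in begin-strict
        ℚ.∣ walkProb p prime m ℓ lam n (b n) (dec n) ℚ.- limitPartial p prime ℓ m lam K ∣
          ≡⟨ cong (λ x → ℚ.∣ x ℚ.- limitPartial p prime ℓ m lam K ∣)
               (walkProb≡limitPartial (ℕₚ.<⇒≤ ℓ<n) K₀ (trans n≡ (sym (ℕₚ.+-suc i K₀))) (b n) (b≢0 n) (dec n)) ⟩
        ℚ.∣ limitPartial p prime ℓ m lam K₀ ℚ.- limitPartial p prime ℓ m lam K ∣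
          ≤⟨ partial-close i K₀≤K (weight ℓ) (0≤weight ℓ) (weight≤1 ℓ) ⟩
        P (suc (i ℕ.+ K₀))
          ≡⟨ cong P (sym n≡) ⟩
        P n
          <⟨ P<ε ε ε>0 n (ℕₚ.m+n≤o⇒n≤o (suc ℓ) N≤n) ⟩
        ε ∎
      where
      i = i₀ ℓ m lam

theorem1p2 : (p : ℕ) (pp : Prime p) (m : ℕ) → 1 ≤ m →
    (ℓ : ℕ) → 1 ≤ ℓ →
    (lam : ℕ → ℕ) → lam 0 ≡ 0 → (∀ i → i < ℓ → lam i ≤ lam (suc i)) → lam ℓ ≤ m →
    (b : (n : ℕ) → Vecℤ (suc n)) → (∀ n → ¬ (∀ i → (+ p) ∣ℤ b n i)) →
    (dec : ∀ n → Decidable (WalkEvent p m ℓ lam n (b n))) →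
    ∀ (ε : ℚ) → ℚ.Positive ε →
    ∃ λ N → ∀ n → N ≤ n → ∃ λ K₀ → ∀ K → K₀ ≤ K →
    ℚ.∣ walkProb p pp m ℓ lam n (b n) (dec n) ℚ.- limitPartial p pp ℓ m lam K ∣ ℚ.< ε
theorem1p2 p pp m 1≤m ℓ _ lam lam₀≡0 lam-step lamₗ≤m =
  Partition.Probability.walkProb-converges ℓ m 1≤m lam lam₀≡0 lam-step lamₗ≤m p pp
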